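{- For every integer $\ell\ge 2$ we have the $e$-positive expansion $$\mathcal{X}_P f_\ell=\mathcal{X}_P\sum_{i=3}^{\ell+1}(i-2)e_iz^i+2\bigl(E+\mathcal{X}_P\,G_{\ge \ell+2}\bigr)+\sum_{i=1}^{\ell-2}\bigl(E+\mathcal{X}_P\,G_{\ge \ell+2-i}\bigr)X_{P_i}z^i .$$ Hence the generating function $\sum_{n\ge \ell+1}X_{P_{n,\ell}}z^{n+1}$ is $e$-positive.
   Context: The chromatic symmetric function of a finite simple graph $H=(V,E)$ is $X_H=\sum_\kappa\prod_{u\in V}x_{\kappa(u)}$, the sum over all proper colorings $\kappa:V\to\mathbb{Z}_{>0}$. $P_n$ is the path with vertices $1,2,\dots,n$ in order ($X_{P_0}=1$). The twin of a graph at a vertex $v$ is obtained by adding a new vertex $v'$ joined to $v$ and to all neighbors of $v$; $P_{n,\ell}$ denotes $P_n$ twinned at the vertex $\ell$ (an interior vertex when $2\le\ell\le n-1$). $e_i$ is the $i$-th elementary symmetric function ($e_0=1$); a symmetric function is $e$-positive if its expansion in the elementary basis has nonnegative coefficients, and a power series in $z$ over symmetric functions is $e$-positive if each of its coefficients is. Notation: $E=E(z)=\sum_{i\ge 0}e_iz^i$, $\mathcal{X}_P=\mathcal{X}_P(z)=\sum_{n\ge 0}X_{P_n}z^n$, $G_{\ge k}=G_{\ge k}(z)=\sum_{i\ge k}(i-1)e_iz^i$, and for $\ell\ge 2$ $$f_\ell=f_\ell(z)=2+e_1z-X_{P_{\ell-1}}z^{\ell-1}(1-e_2z^2)-X_{P_\ell}z^\ell-X_{P_{\ell+1}}z^{\ell+1}.$$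 Empty sums are zero. -}

module Defs where

open import Data.Bool using (if_then_else_)
open import Data.Empty using (⊥)
open import Data.Fin as Fin using (Fin; zero; suc; toℕ; fromℕ<)
import Data.Fin.Properties as Fin
open import Data.Integer as ℤ using (ℤ; +_; 0ℤ; 1ℤ)
open import Data.List using (List; []; _∷_; map; concatMap; foldr; filter; length; allFin; upTo)
import Data.List.Properties as List
open import Data.List.Relation.Unary.All as All using (All)
open import Data.List.Relation.Unary.Linked using (Linked)
open import Data.List.Relation.Unary.Unique.Propositional using (Unique)
open import Data.Nat as ℕ using (ℕ; zero; suc; _≤_; _≥_; _∸_; _≤?_; _≟_)
open import Data.Nat.ListAction using (sum)
import Data.Nat.Properties as ℕ
open import Data.Product using (_×_; _,_; Σ-syntax)
open import Data.Sum using (_⊎_; inj₁; inj₂; swap)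
open import Data.Vec as Vec using (Vec; []; _∷_; lookup; count)
open import Function using (_∘_)
open import Level using (0ℓ)
open import Relation.Binary using (Rel; Symmetric; Irreflexive; Decidable)
open import Relation.Binary.PropositionalEquality using (_≡_; _≢_; refl)
open import Relation.Nullary using (Dec; yes; no; does; ¬?; _×-dec_; _⊎-dec_; _→-dec_)

record Graph (n : ℕ) : Set₁ where
  field
    Adj     : Rel (Fin n) 0ℓ
    sym     : Symmetric Adj
    irrefl  : Irreflexive _≡_ Adj
    adj?    : Decidable Adj

open Graph using (Adj; adj?)

-- The i-th vertex of the path, i = 1, …, n, is the element of Fin n with
-- toℕ equal to i - 1.
path : (n : ℕ) → Graph n
path n = record
  { Adj    = λ i j → suc (toℕ i) ≡ toℕ j ⊎ suc (toℕ j) ≡ toℕ i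
  ; sym    = swap
  ; irrefl = λ { refl (inj₁ p) → ℕ.1+n≢n p ; refl (inj₂ p) → ℕ.1+n≢n p }
  ; adj?   = λ i j → (suc (toℕ i) ≟ toℕ j) ⊎-dec (suc (toℕ j) ≟ toℕ i)
  }

pathVertex : ∀ {n} (ℓ : ℕ) → 1 ≤ ℓ → ℓ ≤ n → Fin n
pathVertex (suc k) _ k<n = fromℕ< k<n

module _ {n : ℕ} (H : Graph n) (v : Fin n) where

  -- The new vertex v′ is zero; an old vertex u becomes suc u.
  TwinAdj : Rel (Fin (suc n)) 0ℓ
  TwinAdj zero    zero    = ⊥
  TwinAdj zero    (suc u) = u ≡ v ⊎ Adj H u v
  TwinAdj (suc u) zero    = u ≡ v ⊎ Adj H u v
  TwinAdj (suc u) (suc w) = Adj H u w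

  twin : Graph (suc n)
  twin = record { Adj = TwinAdj ; sym = λ {i} {j} → tsym i j ; irrefl = λ {i} → tirrefl i ; adj? = tadj? }
    where
    tsym : ∀ i j → TwinAdj i j → TwinAdj j i
    tsym zero    (suc u) p = p
    tsym (suc u) zero    p = p
    tsym (suc u) (suc w) p = Graph.sym H p

    tirrefl : ∀ i {j} → i ≡ j → TwinAdj i j → ⊥
    tirrefl (suc u) refl p = Graph.irrefl H refl p

    tadj? : Decidable TwinAdj
    tadj? zero    zero    = no λ ()
    tadj? zero    (suc u) = (u Fin.≟ v) ⊎-dec adj? H u v
    tadj? (suc u) zero    = (u Fin.≟ v) ⊎-dec adj? H u v
    tadj? (suc u) (suc w) = adj? H u w

twinnedPath : (n ℓ : ℕ) → 1 ≤ ℓ → ℓ ≤ n → Graph (suc n)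
twinnedPath n ℓ 1≤ℓ ℓ≤n = twin (path n) (pathVertex ℓ 1≤ℓ ℓ≤n)

-- A power series over ℤ in the commuting variables x₁, x₂, … is given by its
-- coefficients: F (a₁ ∷ … ∷ aₘ ∷ []) is the coefficient of x₁^a₁ ⋯ xₘ^aₘ.
-- Lists that differ by trailing zeros denote the same monomial; every series
-- and operation below is compatible with that identification.  Symmetric
-- functions form a subring.
ℤ⟦x⟧ : Set
ℤ⟦x⟧ = List ℕ → ℤ

infix 4 _≈_
_≈_ : Rel ℤ⟦x⟧ 0ℓ
F ≈ G = ∀ α → F α ≡ G α

-- All pairs (β , γ) of exponent lists of the length of α with β + γ = α.
splits : List ℕ → List (List ℕ × List ℕ)
splits []      = ([] , []) ∷ []
splits (a ∷ α) =
  concatMap (λ i → map (λ (β , γ) → i ∷ β , (a ∸ i) ∷ γ) (splits α)) (upTo (suc a))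

sumℤ : List ℤ → ℤ
sumℤ = foldr ℤ._+_ 0ℤ

infixl 6 _+ˣ_
infixl 7 _*ˣ_
infixr 8 _·ˣ_

_+ˣ_ : ℤ⟦x⟧ → ℤ⟦x⟧ → ℤ⟦x⟧
(F +ˣ G) α = F α ℤ.+ G α

-ˣ_ : ℤ⟦x⟧ → ℤ⟦x⟧
(-ˣ F) α = ℤ.- F α

_*ˣ_ : ℤ⟦x⟧ → ℤ⟦x⟧ → ℤ⟦x⟧
(F *ˣ G) α = sumℤ (map (λ (β , γ) → F β ℤ.* G γ) (splits α))

_·ˣ_ : ℤ → ℤ⟦x⟧ → ℤ⟦x⟧
(c ·ˣ F) α = c ℤ.* F α

0ˣ : ℤ⟦x⟧
0ˣ α = 0ℤ

1ˣ : ℤ⟦x⟧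
1ˣ α = if does (All.all? (_≟ 0) α) then 1ℤ else 0ℤ

sumˣ : List ℤ⟦x⟧ → ℤ⟦x⟧
sumˣ = foldr _+ˣ_ 0ˣ

productˣ : List ℤ⟦x⟧ → ℤ⟦x⟧
productˣ = foldr _*ˣ_ 1ˣ

-- The elementary symmetric function: the sum of all squarefree monomials of
-- degree i.
e : ℕ → ℤ⟦x⟧
e i α = if does (All.all? (_≤? 1) α ×-dec (sum α ≟ i)) then 1ℤ else 0ℤ

colourings : (n m : ℕ) → List (Vec (Fin m) n)
colourings zero    m = [] ∷ []
colourings (suc n) m = concatMap (λ c → map (c ∷_) (colourings n m)) (allFin m)

Proper : ∀ {n m} → Graph n → Vec (Fin m) n → Set
Proper H κ = ∀ u v → Adj H u v → lookup κ u ≢ lookup κ v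

proper? : ∀ {n m} (H : Graph n) (κ : Vec (Fin m) n) → Dec (Proper H κ)
proper? H κ = Fin.all? λ u → Fin.all? λ v →
  adj? H u v →-dec ¬? (lookup κ u Fin.≟ lookup κ v)

-- The exponents of ∏ᵤ x_{κ(u)}.
exponents : ∀ {n m} → Vec (Fin m) n → List ℕ
exponents {m = m} κ = map (λ c → count (Fin._≟ c) κ) (allFin m)

-- The coefficient of x^α in Σ_κ ∏ᵤ x_{κ(u)} is the number of proper colourings
-- κ with ∏ᵤ x_{κ(u)} = x^α.  If α has length m, such a κ only takes colours
-- in {1, …, m}, represented here by Fin m.
X : ∀ {n} → Graph n → ℤ⟦x⟧
X {n} H α = + length (filter
  (λ κ → proper? H κ ×-dec List.≡-dec _≟_ (exponents κ) α)
  (colourings n (length α)))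

IsPartition : List ℕ → Set
IsPartition p = All (1 ≤_) p × Linked _≥_ p

e[_] : List ℕ → ℤ⟦x⟧
e[ p ] = productˣ (map e p)

-- The e[ p ], p a partition, are linearly independent, so F has at most one
-- expansion up to the order of the support and zero coefficients.
record EExpansion (F : ℤ⟦x⟧) : Set where
  field
    support     : List (List ℕ)
    partitions  : All IsPartition support
    unique      : Unique support
    coefficient : List ℕ → ℤ
    expands     : F ≈ sumˣ (map (λ p → coefficient p ·ˣ e[ p ]) support)

EPositiveˣ : ℤ⟦x⟧ → Set
EPositiveˣ F = Σ[ x ∈ EExpansion F ] All (λ p → 0ℤ ℤ.≤ EExpansion.coefficient x p) (EExpansion.support x)

-- F n is the coefficient of zⁿ.
ℤ⟦x⟧⟦z⟧ : Set
ℤ⟦x⟧⟦z⟧ = ℕ → ℤ⟦x⟧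

EPositive : ℤ⟦x⟧⟦z⟧ → Set
EPositive F = ∀ n → EPositiveˣ (F n)

infix  4 _≋_
infixl 6 _+_ _-_
infixl 7 _*_
infix  9 _z^_

_≋_ : Rel ℤ⟦x⟧⟦z⟧ 0ℓ
F ≋ G = ∀ n → F n ≈ G n

_+_ : ℤ⟦x⟧⟦z⟧ → ℤ⟦x⟧⟦z⟧ → ℤ⟦x⟧⟦z⟧
(F + G) n = F n +ˣ G n

_-_ : ℤ⟦x⟧⟦z⟧ → ℤ⟦x⟧⟦z⟧ → ℤ⟦x⟧⟦z⟧
(F - G) n = F n +ˣ (-ˣ G n)

_*_ : ℤ⟦x⟧⟦z⟧ → ℤ⟦x⟧⟦z⟧ → ℤ⟦x⟧⟦z⟧
(F * G) n = sumˣ (map (λ i → F i *ˣ G (n ∸ i)) (upTo (suc n)))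

_z^_ : ℤ⟦x⟧ → ℕ → ℤ⟦x⟧⟦z⟧
(F z^ k) n = if does (n ≟ k) then F else 0ˣ

const : ℤ → ℤ⟦x⟧⟦z⟧
const c = (c ·ˣ 1ˣ) z^ 0

0ᶻ : ℤ⟦x⟧⟦z⟧
0ᶻ n = 0ˣ

-- Σ[ i from a to b ] F is the sum over a ≤ i ≤ b, zero if b < a.
sumFromTo : ℕ → ℕ → (ℕ → ℤ⟦x⟧⟦z⟧) → ℤ⟦x⟧⟦z⟧
sumFromTo a b F = foldr _+_ 0ᶻ (map (F ∘ (a ℕ.+_)) (upTo (suc b ∸ a)))

infix 5 sumFromTo
syntax sumFromTo a b (λ i → F) = Σ[ i from a to b ] F

E : ℤ⟦x⟧⟦z⟧
E = e

𝒳ₚ : ℤ⟦x⟧⟦z⟧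
𝒳ₚ n = X (path n)

G≥ : ℕ → ℤ⟦x⟧⟦z⟧
G≥ k i = if does (k ≤? i) then (+ i ℤ.- + 1) ·ˣ e i else 0ˣ

f : ℕ → ℤ⟦x⟧⟦z⟧
f ℓ = const (+ 2) + e 1 z^ 1
    - X (path (ℓ ∸ 1)) z^ (ℓ ∸ 1) * (const (+ 1) - e 2 z^ 2)
    - X (path ℓ) z^ ℓ
    - X (path (suc ℓ)) z^ (suc ℓ)

-- Σ_{n ≥ ℓ+1} X_{P_{n,ℓ}} z^{n+1}
𝒳-twinned : (ℓ : ℕ) → 1 ≤ ℓ → ℤ⟦x⟧⟦z⟧
𝒳-twinned ℓ 1≤ℓ zero    = 0ˣ
𝒳-twinned ℓ 1≤ℓ (suc n) with suc ℓ ≤? n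
... | yes ℓ<n = X (twinnedPath n ℓ 1≤ℓ (ℕ.<⇒≤ ℓ<n))
... | no  _   = 0ˣ

{-# OPTIONS --safe #-}

-- Write P_k for X_{P_k}, and p_k(c) for the part of P_k in which the first
-- vertex has colour c.  In finitely many variables p_{k+1}(c) = x_c (P_k − p_k(c)),
-- whence Σ_c p_i(c) p_j(c) = P_i P_j − P_{i+j} and, multiplying the generating
-- function of p(c) by 1 + x_c z, Carlitz's formula 𝒳 = E + 𝒳 G≥2.  Given the
-- last formula, the identity for 𝒳 f_ℓ follows by induction on ℓ, and both
-- 𝒳 and its expansion are visibly e-positive.  Colouring the twins c ≠ d first,
-- a branch of k vertices contributes P_k − p_k(c) − p_k(d); expanding the
-- product of the two branches shows that X_{P_{n,ℓ}} is twice the coefficient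
-- of z^{n+1} in 𝒳 f_ℓ.
module Submission where

open import Algebra.Bundles using (CommutativeRing; RawRing)
import Algebra.Morphism.RingMonomorphism
open import Algebra.Morphism.Structures using (IsRingMonomorphism)
import Algebra.Properties.CommutativeMonoid.Mult
import Algebra.Properties.Ring
import Algebra.Properties.Semiring.Mult
import Algebra.Properties.Semiring.Mult.TCOptimised
import Algebra.Solver.Ring
open import Algebra.Solver.Ring.AlmostCommutativeRing using (fromCommutativeRing; _-Raw-AlmostCommutative⟶_)
open import Algebra.Structures using (IsCommutativeRing)
open import Data.Bool using (if_then_else_; true; false; _∧_)
import Data.Bool.Properties as Bool
open import Data.Fin as Fin using (Fin; zero; suc; toℕ; _↑ʳ_)
import Data.Fin.Properties as Fin
open import Data.Integer as ℤ using (ℤ; +_; -[1+_]; _⊖_; 0ℤ; 1ℤ)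
import Data.Integer.Properties as ℤ
open import Data.List using (List; []; _∷_; map; concatMap; foldr; _++_; upTo; allFin; tabulate; filter; length; deduplicate)
open import Data.List.Membership.Propositional using (_∈_)
open import Data.List.Membership.Propositional.Properties using (∈-deduplicate⁺; ∈-deduplicate⁻)
import Data.List.Properties as List
open import Data.List.Relation.Binary.Permutation.Propositional as ↭ using (_↭_; ↭-sym)
import Data.List.Relation.Binary.Permutation.Propositional.Properties as ↭
open import Data.List.Relation.Unary.All as All using (All; []; _∷_)
import Data.List.Relation.Unary.All.Properties as All
open import Data.List.Relation.Unary.AllPairs using ([]; _∷_)
open import Data.List.Relation.Unary.Any using (here; there)
open import Data.List.Relation.Unary.Unique.DecPropositional.Properties using (deduplicate-!)
open import Data.List.Relation.Unary.Unique.Propositional using (Unique)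
import Data.List.Sort
open import Data.Maybe using (Maybe; just; nothing)
open import Data.Nat as ℕ using (ℕ; zero; suc; _∸_; _≤_; _<_; z≤n; s≤s)
open import Data.Nat.Induction using (<-rec)
import Data.Nat.Properties as ℕ
open import Data.Nat.Properties using (<⇒≤)
open import Data.Product using (_×_; _,_; proj₁)
open import Data.Sum using (_⊎_; inj₁; inj₂)
open import Data.Vec using (Vec; []; _∷_; lookup; toList; fromList; count)
import Data.Vec.Properties as Vec
open import Function using (_∘_; id)
open import Function.Bundles using (_⇔_; mk⇔; module Equivalence)
open import Level using (0ℓ)
import Relation.Binary.Construct.Flip.EqAndOrd as Flip
open import Relation.Binary.Definitions using (tri<; tri≈; tri>)
open import Relation.Binary.PropositionalEquality as ≡ using (_≡_; _≢_)
import Relation.Binary.Reasoning.Setoid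
open import Relation.Nullary using (Dec; yes; no; does; ¬_; ¬?; _×-dec_)
open import Relation.Nullary.Decidable using (dec-true; dec-false; does-⇔)

open import Defs using (Graph; path; twin; colourings; Proper; proper?; exponents; X; ℤ⟦x⟧; splits; e; e[_])
open import Defs using (_+ˣ_; -ˣ_; _*ˣ_; _·ˣ_; 0ˣ; 1ˣ; sumˣ; IsPartition; EPositiveˣ)

-- A sum over colours needs finitely many of them, whereas `ℤ⟦x⟧` has infinitely many variables. The
-- coefficient at a list of length m involves the first m variables only, so every identity is
-- proved in `truncatedRing m` for all m and read off at m = length α. That ring is the power series
-- construction iterated m times over ℤ. Hence the algebra is done over an arbitrary commutative
-- ring, and `seriesRing` serves both for z and for adjoining one more x. The relation c ≢ d is
-- symmetric, so the transfer operator along a path is self-adjoint and a path can be cut at any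
-- vertex. A surplus factor x_c is always removed by the recursion for p_k(c), which trades it for a
-- larger index; so sums over colours reduce to products of two p's. The term e_2 of f_ℓ arises from
-- P_2 = 2 e_2: in the twin formula P_2 is the weight of the twins themselves, and all other terms
-- come in equal pairs.

-- Ring solver with integer coefficients.

module IntegerCoefficients {c ℓ} (R : CommutativeRing c ℓ) where

  open CommutativeRing R hiding (zero)
  open Algebra.Properties.Ring ring using (-0#≈0#; -‿involutive; -‿+-comm; -‿distribˡ-*)
  open Algebra.Properties.Semiring.Mult.TCOptimised semiring using (1+×; ×-homo-+) renaming (_×_ to _•_)
  open Relation.Binary.Reasoning.Setoid setoid

  -- The solver has to compare coefficients, and equality of power series is not decidable;
  -- integers, mapped canonically into R, serve instead.
  ⟦_⟧ : ℤ → Carrier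
  ⟦ + n ⟧      = n • 1#
  ⟦ -[1+ n ] ⟧ = - (suc n • 1#)

  ⊖-homo : ∀ m n → ⟦ m ⊖ n ⟧ ≈ m • 1# - n • 1#
  ⊖-homo m       zero    = sym (trans (+-congˡ -0#≈0#) (+-identityʳ _))
  ⊖-homo zero    (suc n) = sym (+-identityˡ _)
  ⊖-homo (suc m) (suc n) = begin
    ⟦ suc m ⊖ suc n ⟧                    ≡⟨ ≡.cong ⟦_⟧ (ℤ.[1+m]⊖[1+n]≡m⊖n m n) ⟩
    ⟦ m ⊖ n ⟧                            ≈⟨ ⊖-homo m n ⟩
    m • 1# - n • 1#                      ≈⟨ +-identityˡ _ ⟨
    0# + (m • 1# - n • 1#)               ≈⟨ +-congʳ (-‿inverseʳ 1#) ⟨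
    (1# - 1#) + (m • 1# - n • 1#)        ≈⟨ +-assoc _ _ _ ⟩
    1# + (- 1# + (m • 1# - n • 1#))      ≈⟨ +-congˡ (+-assoc _ _ _) ⟨
    1# + ((- 1# + m • 1#) - n • 1#)      ≈⟨ +-congˡ (+-congʳ (+-comm _ _)) ⟩
    1# + ((m • 1# - 1#) - n • 1#)        ≈⟨ +-congˡ (+-assoc _ _ _) ⟩
    1# + (m • 1# + (- 1# - n • 1#))      ≈⟨ +-congˡ (+-congˡ (-‿+-comm _ _)) ⟩
    1# + (m • 1# - (1# + n • 1#))        ≈⟨ +-assoc _ _ _ ⟨
    (1# + m • 1#) - (1# + n • 1#)        ≈⟨ +-cong (1+× m 1#) (-‿cong (1+× n 1#)) ⟨
    suc m • 1# - suc n • 1#              ∎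

  +-homo : ∀ i j → ⟦ i ℤ.+ j ⟧ ≈ ⟦ i ⟧ + ⟦ j ⟧
  +-homo (+ m)      (+ n)      = ×-homo-+ 1# m n
  +-homo (+ m)      -[1+ n ]   = ⊖-homo m (suc n)
  +-homo -[1+ m ]   (+ n)      = trans (⊖-homo n (suc m)) (+-comm _ _)
  +-homo -[1+ m ]   -[1+ n ]   = begin
    - (suc (suc (m ℕ.+ n)) • 1#)         ≡⟨ ≡.cong (λ k → - (suc k • 1#)) (ℕ.+-suc m n) ⟨
    - ((suc m ℕ.+ suc n) • 1#)           ≈⟨ -‿cong (×-homo-+ 1# (suc m) (suc n)) ⟩
    - (suc m • 1# + suc n • 1#)          ≈⟨ -‿+-comm _ _ ⟨
    - (suc m • 1#) - suc n • 1#          ∎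

  -‿homo : ∀ i → ⟦ ℤ.- i ⟧ ≈ - ⟦ i ⟧
  -‿homo (+ zero)  = sym -0#≈0#
  -‿homo (+ suc n) = refl
  -‿homo -[1+ n ]  = sym (-‿involutive _)

  +*-homo : ∀ n j → ⟦ + n ℤ.* j ⟧ ≈ n • 1# * ⟦ j ⟧
  +*-homo zero    j = trans (reflexive (≡.cong ⟦_⟧ (ℤ.*-zeroˡ j))) (sym (zeroˡ _))
  +*-homo (suc n) j = begin
    ⟦ + suc n ℤ.* j ⟧                    ≡⟨ ≡.cong ⟦_⟧ (ℤ.suc-* (+ n) j) ⟩
    ⟦ j ℤ.+ + n ℤ.* j ⟧                  ≈⟨ +-homo j (+ n ℤ.* j) ⟩
    ⟦ j ⟧ + ⟦ + n ℤ.* j ⟧                ≈⟨ +-cong (sym (*-identityˡ _)) (+*-homo n j) ⟩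
    1# * ⟦ j ⟧ + n • 1# * ⟦ j ⟧          ≈⟨ distribʳ _ _ _ ⟨
    (1# + n • 1#) * ⟦ j ⟧                ≈⟨ *-congʳ (1+× n 1#) ⟨
    suc n • 1# * ⟦ j ⟧                   ∎

  *-homo : ∀ i j → ⟦ i ℤ.* j ⟧ ≈ ⟦ i ⟧ * ⟦ j ⟧
  *-homo (+ n)     j = +*-homo n j
  *-homo -[1+ n ]  j = begin
    ⟦ -[1+ n ] ℤ.* j ⟧                   ≡⟨ ≡.cong ⟦_⟧ (ℤ.neg-distribˡ-* (+ suc n) j) ⟨
    ⟦ ℤ.- (+ suc n ℤ.* j) ⟧              ≈⟨ -‿homo (+ suc n ℤ.* j) ⟩
    - ⟦ + suc n ℤ.* j ⟧                  ≈⟨ -‿cong (+*-homo (suc n) j) ⟩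
    - (suc n • 1# * ⟦ j ⟧)               ≈⟨ -‿distribˡ-* _ _ ⟩
    - (suc n • 1#) * ⟦ j ⟧               ∎

  morphism : ℤ.+-*-rawRing -Raw-AlmostCommutative⟶ fromCommutativeRing R
  morphism = record
    { ⟦_⟧    = ⟦_⟧
    ; +-homo = +-homo
    ; *-homo = *-homo
    ; -‿homo = -‿homo
    ; 0-homo = refl
    ; 1-homo = refl
    }

  _≟_ : ∀ i j → Maybe (⟦ i ⟧ ≈ ⟦ j ⟧)
  i ≟ j with i ℤ.≟ j
  ... | yes i≡j = just (reflexive (≡.cong ⟦_⟧ i≡j))
  ... | no  _   = nothing

module Solver {c ℓ} (R : CommutativeRing c ℓ) where

  open IntegerCoefficients R using (morphism; _≟_)
  open Algebra.Solver.Ring ℤ.+-*-rawRing (fromCommutativeRing R) morphism _≟_ public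
    using (solve; _:=_; _:+_; _:*_; _:-_; :-_; con)

-- Finite sums and the ring of power series in one variable.

module ListSum {c ℓ} (R : CommutativeRing c ℓ) where

  open CommutativeRing R hiding (zero)
  open Algebra.Properties.Ring ring using (-0#≈0#; -‿+-comm)
  open Solver R

  ∑ : ∀ {a} {A : Set a} → List A → (A → Carrier) → Carrier
  ∑ as g = foldr _+_ 0# (map g as)

  module _ {a} {A : Set a} where

    ∑-cong : ∀ (as : List A) {g h : A → Carrier} → (∀ a → g a ≈ h a) → ∑ as g ≈ ∑ as h
    ∑-cong []       g≈h = refl
    ∑-cong (a ∷ as) g≈h = +-cong (g≈h a) (∑-cong as g≈h)

    ∑-zero : ∀ (as : List A) → ∑ as (λ _ → 0#) ≈ 0#
    ∑-zero []       = refl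
    ∑-zero (a ∷ as) = trans (+-identityˡ _) (∑-zero as)

    ∑-+ : ∀ (as : List A) (g h : A → Carrier) → ∑ as (λ a → g a + h a) ≈ ∑ as g + ∑ as h
    ∑-+ []       g h = sym (+-identityˡ _)
    ∑-+ (a ∷ as) g h = trans (+-congˡ (∑-+ as g h))
      (solve 4 (λ p q r s → (p :+ q) :+ (r :+ s) := (p :+ r) :+ (q :+ s)) refl _ _ _ _)

    ∑-neg : ∀ (as : List A) (g : A → Carrier) → ∑ as (λ a → - g a) ≈ - ∑ as g
    ∑-neg []       g = sym -0#≈0#
    ∑-neg (a ∷ as) g = trans (+-congˡ (∑-neg as g)) (-‿+-comm _ _)

    ∑-- : ∀ (as : List A) (g h : A → Carrier) → ∑ as (λ a → g a - h a) ≈ ∑ as g - ∑ as h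
    ∑-- as g h = trans (∑-+ as g (λ a → - h a)) (+-congˡ (∑-neg as h))

    *-∑ : ∀ y (as : List A) (g : A → Carrier) → ∑ as (λ a → y * g a) ≈ y * ∑ as g
    *-∑ y []       g = sym (zeroʳ y)
    *-∑ y (a ∷ as) g = trans (+-congˡ (*-∑ y as g)) (sym (distribˡ _ _ _))

    ∑-* : ∀ (as : List A) (g : A → Carrier) y → ∑ as (λ a → g a * y) ≈ ∑ as g * y
    ∑-* as g y = trans (∑-cong as λ a → *-comm (g a) y) (trans (*-∑ y as g) (*-comm _ _))

    ∑-++ : ∀ (as bs : List A) g → ∑ (as ++ bs) g ≈ ∑ as g + ∑ bs g
    ∑-++ []       bs g = sym (+-identityˡ _)
    ∑-++ (a ∷ as) bs g = trans (+-congˡ (∑-++ as bs g)) (sym (+-assoc _ _ _))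

    ∑-map : ∀ {b} {B : Set b} (h : B → A) (bs : List B) g → ∑ (map h bs) g ≡ ∑ bs (g ∘ h)
    ∑-map h bs g = ≡.cong (foldr _+_ 0#) (≡.sym (List.map-∘ bs))

    ∑-concatMap : ∀ {b} {B : Set b} (h : B → List A) (bs : List B) g →
                  ∑ (concatMap h bs) g ≈ ∑ bs (λ b → ∑ (h b) g)
    ∑-concatMap h []       g = refl
    ∑-concatMap h (b ∷ bs) g = trans (∑-++ (h b) _ g) (+-congˡ (∑-concatMap h bs g))

  ∑-swap : ∀ {a b} {A : Set a} {B : Set b} (as : List A) (bs : List B) (g : A → B → Carrier) →
           ∑ as (λ a → ∑ bs (g a)) ≈ ∑ bs (λ b → ∑ as (λ a → g a b))
  ∑-swap []       bs g = sym (∑-zero bs)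
  ∑-swap (a ∷ as) bs g = trans (+-congˡ (∑-swap as bs g)) (sym (∑-+ bs _ _))

  ∑-upTo-suc : ∀ n (g : ℕ → Carrier) → ∑ (upTo (suc n)) g ≡ g 0 + ∑ (upTo n) (g ∘ suc)
  ∑-upTo-suc n g = ≡.cong (λ xs → g 0 + foldr _+_ 0# xs)
    (≡.trans (List.map-applyUpTo suc g n) (≡.sym (List.map-applyUpTo id (g ∘ suc) n)))

  ∑-upTo-cong : ∀ n {g h : ℕ → Carrier} → (∀ i → i < n → g i ≈ h i) → ∑ (upTo n) g ≈ ∑ (upTo n) h
  ∑-upTo-cong zero    eq = refl
  ∑-upTo-cong (suc n) {g} {h} eq = trans (reflexive (∑-upTo-suc n g)) (trans
    (+-cong (eq 0 (s≤s z≤n)) (∑-upTo-cong n λ i i<n → eq (suc i) (s≤s i<n))) (reflexive (≡.sym (∑-upTo-suc n h))))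

  ∑-upTo-last : ∀ n (g : ℕ → Carrier) → ∑ (upTo (suc n)) g ≈ ∑ (upTo n) g + g n
  ∑-upTo-last zero    g = +-comm _ _
  ∑-upTo-last (suc n) g = trans (reflexive (∑-upTo-suc (suc n) g)) (trans
    (+-congˡ (∑-upTo-last n (g ∘ suc))) (trans (sym (+-assoc _ _ _)) (+-congʳ (reflexive (≡.sym (∑-upTo-suc n g))))))

module PowerSeries {c ℓ} (R : CommutativeRing c ℓ) where

  open CommutativeRing R hiding (zero)
  open ListSum R
  open Solver R
  open Relation.Binary.Reasoning.Setoid setoid

  Series : Set c
  Series = ℕ → Carrier

  infix  4 _≋_
  infixl 7 _⊛_

  _≋_ : Series → Series → Set ℓ
  F ≋ G = ∀ n → F n ≈ G n

  _⊛_ : Series → Series → Series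
  (F ⊛ G) n = ∑ (upTo (suc n)) (λ i → F i * G (n ∸ i))

  one : Series
  one zero    = 1#
  one (suc n) = 0#

  tail : Series → Series
  tail F n = F (suc n)

  ⊛-head : ∀ F G → (F ⊛ G) 0 ≈ F 0 * G 0
  ⊛-head F G = +-identityʳ _

  ⊛-tail : ∀ F G n → (F ⊛ G) (suc n) ≈ F 0 * G (suc n) + (tail F ⊛ G) n
  ⊛-tail F G n = reflexive (∑-upTo-suc (suc n) (λ i → F i * G (suc n ∸ i)))

  ⊛-cong : ∀ {F F′ G G′} → F ≋ F′ → G ≋ G′ → F ⊛ G ≋ F′ ⊛ G′
  ⊛-cong F≋F′ G≋G′ n = ∑-cong (upTo (suc n)) λ i → *-cong (F≋F′ i) (G≋G′ (n ∸ i))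

  ⊛-zeroˡ : ∀ G n → ((λ _ → 0#) ⊛ G) n ≈ 0#
  ⊛-zeroˡ G n = trans (∑-cong (upTo (suc n)) λ i → zeroˡ _) (∑-zero (upTo (suc n)))

  scale-⊛ : ∀ y F G n → ((λ i → y * F i) ⊛ G) n ≈ y * (F ⊛ G) n
  scale-⊛ y F G n = trans (∑-cong (upTo (suc n)) λ i → *-assoc _ _ _) (*-∑ y (upTo (suc n)) _)

  ⊛-distribʳ : ∀ H F G n → ((λ i → F i + G i) ⊛ H) n ≈ (F ⊛ H) n + (G ⊛ H) n
  ⊛-distribʳ H F G n = trans (∑-cong (upTo (suc n)) λ i → distribʳ _ _ _) (∑-+ (upTo (suc n)) _ _)

  -- The mirror image of `⊛-tail`, peeling the constant term off the second factor; exchanging the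
  -- factors swaps the two rules, which gives commutativity by induction on the degree.
  ⊛-tailʳ : ∀ F G n → (F ⊛ G) (suc n) ≈ F (suc n) * G 0 + (F ⊛ tail G) n
  ⊛-tailʳ F G zero    = trans (⊛-tail F G 0) (trans (+-cong (sym (⊛-head F (tail G))) (⊛-head (tail F) G)) (+-comm _ _))
  ⊛-tailʳ F G (suc n) = begin
    (F ⊛ G) (suc (suc n))                                                     ≈⟨ ⊛-tail F G (suc n) ⟩
    F 0 * G (suc (suc n)) + (tail F ⊛ G) (suc n)                              ≈⟨ +-congˡ (⊛-tailʳ (tail F) G n) ⟩
    F 0 * G (suc (suc n)) + (F (suc (suc n)) * G 0 + (tail F ⊛ tail G) n)
      ≈⟨ solve 3 (λ a b c → a :+ (b :+ c) := b :+ (a :+ c)) refl _ _ _ ⟩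
    F (suc (suc n)) * G 0 + (F 0 * G (suc (suc n)) + (tail F ⊛ tail G) n)     ≈⟨ +-congˡ (⊛-tail F (tail G) n) ⟨
    F (suc (suc n)) * G 0 + (F ⊛ tail G) (suc n)                              ∎

  ⊛-comm : ∀ F G → F ⊛ G ≋ G ⊛ F
  ⊛-comm F G zero    = trans (⊛-head F G) (trans (*-comm _ _) (sym (⊛-head G F)))
  ⊛-comm F G (suc n) = begin
    (F ⊛ G) (suc n)                      ≈⟨ ⊛-tail F G n ⟩
    F 0 * G (suc n) + (tail F ⊛ G) n     ≈⟨ +-cong (*-comm _ _) (⊛-comm (tail F) G n) ⟩
    G (suc n) * F 0 + (G ⊛ tail F) n     ≈⟨ ⊛-tailʳ G F n ⟨
    (G ⊛ F) (suc n)                      ∎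

  -- Induction on the degree, peeling the constant term off F, replaces the reindexing of a triple
  -- sum.
  ⊛-assoc : ∀ F G H → (F ⊛ G) ⊛ H ≋ F ⊛ (G ⊛ H)
  ⊛-assoc F G H zero = begin
    ((F ⊛ G) ⊛ H) 0       ≈⟨ ⊛-head (F ⊛ G) H ⟩
    (F ⊛ G) 0 * H 0       ≈⟨ *-congʳ (⊛-head F G) ⟩
    F 0 * G 0 * H 0       ≈⟨ *-assoc _ _ _ ⟩
    F 0 * (G 0 * H 0)     ≈⟨ *-congˡ (⊛-head G H) ⟨
    F 0 * (G ⊛ H) 0       ≈⟨ ⊛-head F (G ⊛ H) ⟨
    (F ⊛ (G ⊛ H)) 0       ∎
  ⊛-assoc F G H (suc n) = begin
    ((F ⊛ G) ⊛ H) (suc n)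
      ≈⟨ ⊛-tail (F ⊛ G) H n ⟩
    (F ⊛ G) 0 * H (suc n) + (tail (F ⊛ G) ⊛ H) n
      ≈⟨ +-cong (*-congʳ (⊛-head F G)) (⊛-cong {G = H} (⊛-tail F G) (λ _ → refl) n) ⟩
    F 0 * G 0 * H (suc n) + ((λ i → F 0 * G (suc i) + (tail F ⊛ G) i) ⊛ H) n
      ≈⟨ +-congˡ (⊛-distribʳ H (λ i → F 0 * G (suc i)) (tail F ⊛ G) n) ⟩
    F 0 * G 0 * H (suc n) + (((λ i → F 0 * tail G i) ⊛ H) n + ((tail F ⊛ G) ⊛ H) n)
      ≈⟨ +-congˡ (+-cong (scale-⊛ (F 0) (tail G) H n) (⊛-assoc (tail F) G H n)) ⟩
    F 0 * G 0 * H (suc n) + (F 0 * (tail G ⊛ H) n + (tail F ⊛ (G ⊛ H)) n)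
      ≈⟨ solve 5 (λ a b c d e → a :* b :* c :+ (a :* d :+ e) := a :* (b :* c :+ d) :+ e) refl _ _ _ _ _ ⟩
    F 0 * (G 0 * H (suc n) + (tail G ⊛ H) n) + (tail F ⊛ (G ⊛ H)) n
      ≈⟨ +-congʳ (*-congˡ (⊛-tail G H n)) ⟨
    F 0 * (G ⊛ H) (suc n) + (tail F ⊛ (G ⊛ H)) n
      ≈⟨ ⊛-tail F (G ⊛ H) n ⟨
    (F ⊛ (G ⊛ H)) (suc n) ∎

  ⊛-identityˡ : ∀ F → one ⊛ F ≋ F
  ⊛-identityˡ F zero    = trans (⊛-head one F) (*-identityˡ _)
  ⊛-identityˡ F (suc n) = begin
    (one ⊛ F) (suc n)                          ≈⟨ ⊛-tail one F n ⟩
    1# * F (suc n) + (tail one ⊛ F) n          ≈⟨ +-cong (*-identityˡ _) (⊛-zeroˡ F n) ⟩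
    F (suc n) + 0#                             ≈⟨ +-identityʳ _ ⟩
    F (suc n)                                  ∎

  seriesRing : CommutativeRing c ℓ
  seriesRing = record
    { Carrier = Series
    ; _≈_ = _≋_
    ; _+_ = λ F G n → F n + G n
    ; _*_ = _⊛_
    ; -_  = λ F n → - F n
    ; 0#  = λ _ → 0#
    ; 1#  = one
    ; isCommutativeRing = record
      { isRing = record
        { +-isAbelianGroup = record
          { isGroup = record
            { isMonoid = record
              { isSemigroup = record
                { isMagma = record
                  { isEquivalence = record
                    { refl  = λ _ → refl
                    ; sym   = λ F≋G n → sym (F≋G n)
                    ; trans = λ F≋G G≋H n → trans (F≋G n) (G≋H n)
                    }
                  ; ∙-cong = λ p q n → +-cong (p n) (q n)
                  }
                ; assoc = λ F G H n → +-assoc _ _ _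
                }
              ; identity = (λ F n → +-identityˡ _) , (λ F n → +-identityʳ _)
              }
            ; inverse = (λ F n → -‿inverseˡ _) , (λ F n → -‿inverseʳ _)
            ; ⁻¹-cong = λ p n → -‿cong (p n)
            }
          ; comm = λ F G n → +-comm _ _
          }
        ; *-cong = ⊛-cong
        ; *-assoc = ⊛-assoc
        ; *-identity = ⊛-identityˡ , (λ F n → trans (⊛-comm F one n) (⊛-identityˡ F n))
        ; distrib = (λ H F G n → trans (⊛-comm H (λ i → F i + G i) n)
                                 (trans (⊛-distribʳ H F G n) (+-cong (⊛-comm F H n) (⊛-comm G H n))))
                  , ⊛-distribʳ
        }
      ; *-comm = ⊛-comm
      }
    }

-- Sums over colours and weighted colourings of paths.

module Indicator {c ℓ} (R : CommutativeRing c ℓ) where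

  open CommutativeRing R hiding (zero)
  open ListSum R
  open Solver R
  open Relation.Binary.Reasoning.Setoid setoid

  ind : ∀ {a} {A : Set a} → Dec A → Carrier
  ind A? = if does A? then 1# else 0#

  [_≢_] : ∀ {m} → Fin m → Fin m → Carrier
  [ c ≢ d ] = ind (¬? (c Fin.≟ d))

  ind-complement : ∀ {a} {A : Set a} (A? : Dec A) → ind (¬? A?) ≈ 1# - ind A?
  ind-complement A? with does A?
  ... | true  = sym (-‿inverseʳ 1#)
  ... | false = solve 0 (con (+ 1) := con (+ 1) :- con (+ 0)) refl

  ≢-sym : ∀ {m} (c d : Fin m) → [ c ≢ d ] ≡ [ d ≢ c ]
  ≢-sym Fin.zero    Fin.zero    = ≡.refl
  ≢-sym Fin.zero    (Fin.suc d) = ≡.refl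
  ≢-sym (Fin.suc c) Fin.zero    = ≡.refl
  ≢-sym (Fin.suc c) (Fin.suc d) = ≢-sym c d

  ≢-idem : ∀ {m} (c d : Fin m) → [ c ≢ d ] * [ c ≢ d ] ≈ [ c ≢ d ]
  ≢-idem c d with does (c Fin.≟ d)
  ... | true  = zeroˡ _
  ... | false = *-identityˡ _

  ∑-allFin-suc : ∀ m (g : Fin (suc m) → Carrier) →
                 ∑ (allFin (suc m)) g ≡ g Fin.zero + ∑ (allFin m) (g ∘ Fin.suc)
  ∑-allFin-suc m g = ≡.cong (λ as → g Fin.zero + foldr _+_ 0# as)
    (≡.trans (List.map-tabulate Fin.suc g) (≡.sym (List.map-tabulate id (g ∘ Fin.suc))))

  ∑-δ : ∀ {m} (c : Fin m) (g : Fin m → Carrier) → ∑ (allFin m) (λ d → ind (c Fin.≟ d) * g d) ≈ g c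
  ∑-δ {suc m} Fin.zero g = begin
    ∑ (allFin (suc m)) (λ d → ind (Fin.zero Fin.≟ d) * g d)   ≡⟨ ∑-allFin-suc m _ ⟩
    1# * g Fin.zero + ∑ (allFin m) (λ d → 0# * g (Fin.suc d)) ≈⟨ +-cong (*-identityˡ _) (∑-cong (allFin m) λ d → zeroˡ _) ⟩
    g Fin.zero + ∑ (allFin m) (λ d → 0#)                      ≈⟨ +-congˡ (∑-zero (allFin m)) ⟩
    g Fin.zero + 0#                                           ≈⟨ +-identityʳ _ ⟩
    g Fin.zero                                                ∎
  ∑-δ {suc m} (Fin.suc c) g = begin
    ∑ (allFin (suc m)) (λ d → ind (Fin.suc c Fin.≟ d) * g d)               ≡⟨ ∑-allFin-suc m _ ⟩
    0# * g Fin.zero + ∑ (allFin m) (λ d → ind (c Fin.≟ d) * g (Fin.suc d)) ≈⟨ +-cong (zeroˡ _) (∑-δ c (g ∘ Fin.suc)) ⟩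
    0# + g (Fin.suc c)                                                     ≈⟨ +-identityˡ _ ⟩
    g (Fin.suc c)                                                          ∎

  ∑-≢ : ∀ {m} (c : Fin m) (g : Fin m → Carrier) →
        ∑ (allFin m) (λ d → [ c ≢ d ] * g d) ≈ ∑ (allFin m) g - g c
  ∑-≢ {m} c g = begin
    ∑ (allFin m) (λ d → [ c ≢ d ] * g d)
      ≈⟨ ∑-cong (allFin m) (λ d → trans (*-congʳ (ind-complement (c Fin.≟ d)))
           (solve 2 (λ i y → (con (+ 1) :- i) :* y := y :- i :* y) refl _ _)) ⟩
    ∑ (allFin m) (λ d → g d - ind (c Fin.≟ d) * g d)
      ≈⟨ ∑-- (allFin m) g _ ⟩
    ∑ (allFin m) g - ∑ (allFin m) (λ d → ind (c Fin.≟ d) * g d)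
      ≈⟨ +-congˡ (-‿cong (∑-δ c g)) ⟩
    ∑ (allFin m) g - g c ∎

  -- Removing d after c subtracts only [ c ≢ d ] * g d, as nothing is left to remove when d = c; the
  -- outer factor is idempotent and absorbs this indicator.
  ∑-≢-≢ : ∀ {m} (c d : Fin m) (g : Fin m → Carrier) →
          [ c ≢ d ] * ∑ (allFin m) (λ b → [ d ≢ b ] * ([ c ≢ b ] * g b)) ≈
          [ c ≢ d ] * (∑ (allFin m) g - g c - g d)
  ∑-≢-≢ {m} c d g = begin
    [ c ≢ d ] * ∑ (allFin m) (λ b → [ d ≢ b ] * ([ c ≢ b ] * g b))
      ≈⟨ *-congˡ (trans (∑-≢ d (λ b → [ c ≢ b ] * g b)) (+-congʳ (∑-≢ c g))) ⟩
    [ c ≢ d ] * (∑ (allFin m) g - g c - [ c ≢ d ] * g d)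
      ≈⟨ solve 3 (λ n s y → n :* (s :- n :* y) := n :* s :- (n :* n) :* y) refl _ _ _ ⟩
    [ c ≢ d ] * (∑ (allFin m) g - g c) - ([ c ≢ d ] * [ c ≢ d ]) * g d
      ≈⟨ +-congˡ (-‿cong (*-congʳ (≢-idem c d))) ⟩
    [ c ≢ d ] * (∑ (allFin m) g - g c) - [ c ≢ d ] * g d
      ≈⟨ solve 3 (λ n s y → n :* s :- n :* y := n :* (s :- y)) refl _ _ _ ⟩
    [ c ≢ d ] * (∑ (allFin m) g - g c - g d) ∎

module PathSum {c ℓ} (R : CommutativeRing c ℓ) {m : ℕ} (x : Fin m → CommutativeRing.Carrier R) where

  open CommutativeRing R hiding (zero)
  open ListSum R
  open Indicator R
  open Solver R
  open Relation.Binary.Reasoning.Setoid setoid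

  ∑ᶜ : (Fin m → Carrier) → Carrier
  ∑ᶜ = ∑ (allFin m)

  -- The transfer matrix of proper colourings: d is the colour of the next vertex, and g d the
  -- weight of what lies beyond it.
  transfer : (Fin m → Carrier) → Fin m → Carrier
  transfer g c = ∑ᶜ λ d → [ c ≢ d ] * (x d * g d)

  transfer^ : ℕ → (Fin m → Carrier) → Fin m → Carrier
  transfer^ zero    g = g
  transfer^ (suc k) g = transfer (transfer^ k g)

  -- u k c and p k c are the weights of the proper colourings of the path with
  -- k vertices whose first vertex does not have, respectively has, colour c.
  u : ℕ → Fin m → Carrier
  u k = transfer^ k λ _ → 1#

  p : ℕ → Fin m → Carrier
  p zero    c = 0#
  p (suc k) c = x c * u k c

  P : ℕ → Carrier
  P zero    = 1#
  P (suc k) = ∑ᶜ (p (suc k))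

  u≈P-p : ∀ k c → u k c ≈ P k - p k c
  u≈P-p zero    c = solve 0 (con (+ 1) := con (+ 1) :- con (+ 0)) refl
  u≈P-p (suc k) c = ∑-≢ c (p (suc k))

  p-suc : ∀ k c → p (suc k) c ≈ x c * P k - x c * p k c
  p-suc k c = trans (*-congˡ (u≈P-p k c)) (solve 3 (λ a b d → a :* (b :- d) := a :* b :- a :* d) refl _ _ _)

  -- [ c ≢ d ] is symmetric, so `transfer` is self-adjoint for the bilinear form with weights x c.
  transfer-adjoint : ∀ g h → ∑ᶜ (λ c → x c * (g c * transfer h c)) ≈ ∑ᶜ (λ c → x c * (transfer g c * h c))
  transfer-adjoint g h = begin
    ∑ᶜ (λ c → x c * (g c * transfer h c))
      ≈⟨ ∑-cong (allFin m) (λ c → trans (*-congˡ (sym (*-∑ _ (allFin m) _))) (sym (*-∑ _ (allFin m) _))) ⟩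
    ∑ᶜ (λ c → ∑ᶜ λ d → x c * (g c * ([ c ≢ d ] * (x d * h d))))
      ≈⟨ ∑-swap (allFin m) (allFin m) _ ⟩
    ∑ᶜ (λ d → ∑ᶜ λ c → x c * (g c * ([ c ≢ d ] * (x d * h d))))
      ≈⟨ ∑-cong (allFin m) (λ d → ∑-cong (allFin m) λ c → trans
           (*-congˡ (*-congˡ (*-congʳ (reflexive (≢-sym c d)))))
           (solve 5 (λ a b n e f → a :* (b :* (n :* (e :* f))) := e :* ((n :* (a :* b)) :* f)) refl _ _ _ _ _)) ⟩
    ∑ᶜ (λ d → ∑ᶜ λ c → x d * (([ d ≢ c ] * (x c * g c)) * h d))
      ≈⟨ ∑-cong (allFin m) (λ d → trans (*-∑ _ (allFin m) _) (*-congˡ (∑-* (allFin m) _ _))) ⟩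
    ∑ᶜ (λ d → x d * (transfer g d * h d)) ∎

  -- Moves k steps from one arm of a path to the other, one adjoint step at a time; this is what
  -- permits cutting a path at an arbitrary vertex.
  ∑-transfer^ : ∀ i k g → ∑ᶜ (λ c → x c * (u i c * transfer^ k g c)) ≈ ∑ᶜ (λ c → x c * (u (i ℕ.+ k) c * g c))
  ∑-transfer^ i zero    g = reflexive (≡.cong (λ k → ∑ᶜ (λ c → x c * (u k c * g c))) (≡.sym (ℕ.+-identityʳ i)))
  ∑-transfer^ i (suc k) g = begin
    ∑ᶜ (λ c → x c * (u i c * transfer (transfer^ k g) c))     ≈⟨ transfer-adjoint (u i) (transfer^ k g) ⟩
    ∑ᶜ (λ c → x c * (u (suc i) c * transfer^ k g c))          ≈⟨ ∑-transfer^ (suc i) k g ⟩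
    ∑ᶜ (λ c → x c * (u (suc i ℕ.+ k) c * g c))                ≡⟨ ≡.cong (λ l → ∑ᶜ (λ c → x c * (u l c * g c))) (ℕ.+-suc i k) ⟨
    ∑ᶜ (λ c → x c * (u (i ℕ.+ suc k) c * g c))                ∎

  -- Pairs of colourings whose first vertices differ are the proper colourings of the path on i + j
  -- vertices made by joining these ends; pairs with equal first colours are the rest. The
  -- conventions p 0 c = 0 and P 0 = 1 make empty paths fit.
  ∑-p-p : ∀ i j → ∑ᶜ (λ c → p i c * p j c) ≈ P i * P j - P (i ℕ.+ j)
  ∑-p-p zero    j = trans (∑-cong (allFin m) λ c → zeroˡ _) (trans (∑-zero (allFin m))
    (solve 1 (λ a → con (+ 0) := con (+ 1) :* a :- a) refl _))
  ∑-p-p (suc i) j = begin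
    ∑ᶜ (λ c → p (suc i) c * p j c)
      ≈⟨ ∑-cong (allFin m) (λ c → solve 3 (λ a b d → a :* b := a :* d :- a :* (d :- b)) refl _ _ _) ⟩
    ∑ᶜ (λ c → p (suc i) c * P j - p (suc i) c * (P j - p j c))
      ≈⟨ ∑-- (allFin m) _ _ ⟩
    ∑ᶜ (λ c → p (suc i) c * P j) - ∑ᶜ (λ c → p (suc i) c * (P j - p j c))
      ≈⟨ +-cong (∑-* (allFin m) _ _) (-‿cong (∑-cong (allFin m) λ c →
           trans (*-congˡ (sym (u≈P-p j c))) (*-assoc _ _ _))) ⟩
    P (suc i) * P j - ∑ᶜ (λ c → x c * (u i c * u j c))
      ≈⟨ +-congˡ (-‿cong (trans (∑-transfer^ i j (λ _ → 1#)) (∑-cong (allFin m) λ c → *-congˡ (*-identityʳ _)))) ⟩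
    P (suc i) * P j - P (suc i ℕ.+ j) ∎

  ∑-x : ∑ᶜ x ≈ P 1
  ∑-x = ∑-cong (allFin m) λ c → sym (*-identityʳ _)

  ∑-x-p : ∀ i → ∑ᶜ (λ c → x c * p i c) ≈ P 1 * P i - P (suc i)
  ∑-x-p i = trans (∑-cong (allFin m) λ c → *-congʳ (sym (*-identityʳ _))) (∑-p-p 1 i)

  -- By `p-suc`, x c * p i c is x c * P i minus p (suc i) c, which reduces the triple product to
  -- sums of two p's.
  ∑-x-p-p : ∀ i j → ∑ᶜ (λ c → x c * (p i c * p j c)) ≈ P i * (P 1 * P j - P (suc j)) - (P (suc i) * P j - P (suc i ℕ.+ j))
  ∑-x-p-p i j = begin
    ∑ᶜ (λ c → x c * (p i c * p j c))
      ≈⟨ ∑-cong (allFin m) (λ c → solve 4 (λ y a b e → y :* (a :* b) := e :* (y :* b) :- (y :* e :- y :* a) :* b) refl _ _ _ (P i)) ⟩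
    ∑ᶜ (λ c → P i * (x c * p j c) - (x c * P i - x c * p i c) * p j c)
      ≈⟨ ∑-- (allFin m) _ _ ⟩
    ∑ᶜ (λ c → P i * (x c * p j c)) - ∑ᶜ (λ c → (x c * P i - x c * p i c) * p j c)
      ≈⟨ +-cong (trans (*-∑ _ (allFin m) _) (*-congˡ (∑-x-p j)))
           (-‿cong (trans (∑-cong (allFin m) λ c → *-congʳ (sym (p-suc i c))) (∑-p-p (suc i) j))) ⟩
    P i * (P 1 * P j - P (suc j)) - (P (suc i) * P j - P (suc i ℕ.+ j)) ∎

-- The weight of a path twinned at an interior vertex or at its end.

module TwinFormula {c ℓ} (R : CommutativeRing c ℓ) where

  open CommutativeRing R hiding (zero)

  -- Here i vertices precede the twinned vertex and j follow it. C collects half of every term but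
  -- the last, which is halved only later, by P 2 = 2 e 2.
  twinFormula : (ℕ → Carrier) → ℕ → ℕ → Carrier
  twinFormula P i j = C + C + P i * P 2 * P j
    where
    C = P (suc (suc i ℕ.+ j)) + P (suc (suc i ℕ.+ j)) + P 1 * P (suc i ℕ.+ j) - P (suc i) * P (suc j)
          - P i * P (suc (suc j)) - P (suc (suc i)) * P j

  twinFormula-cong : ∀ {P Q} → (∀ n → P n ≈ Q n) → ∀ i j → twinFormula P i j ≈ twinFormula Q i j
  twinFormula-cong {P} {Q} P≈Q i j = +-cong (+-cong C≈ C≈) (*-cong (*-cong (P≈Q _) (P≈Q _)) (P≈Q _))
    where
    C≈ = +-cong (+-cong (+-cong (+-cong (+-cong (P≈Q (suc (suc i ℕ.+ j))) (P≈Q (suc (suc i ℕ.+ j))))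
           (*-cong (P≈Q 1) (P≈Q (suc i ℕ.+ j))))
           (-‿cong (*-cong (P≈Q (suc i)) (P≈Q (suc j)))))
           (-‿cong (*-cong (P≈Q i) (P≈Q (suc (suc j))))))
           (-‿cong (*-cong (P≈Q (suc (suc i))) (P≈Q j)))

module TwinSum {c ℓ} (R : CommutativeRing c ℓ) {m : ℕ} (x : Fin m → CommutativeRing.Carrier R) where

  open CommutativeRing R hiding (zero)
  open ListSum R
  open Indicator R
  open PathSum R x
  open TwinFormula R
  open Solver R
  open Relation.Binary.Reasoning.Setoid setoid

  -- The weight of a path with j vertices whose first vertex is joined to two
  -- vertices of colours c and d.
  branch : ℕ → Fin m → Fin m → Carrier
  branch zero    c d = 1#
  branch (suc j) c d = ∑ᶜ λ e → [ d ≢ e ] * ([ c ≢ e ] * p (suc j) e)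

  -- The seed for the transfer along the first branch: everything beyond its last vertex, of colour
  -- b, when the new twin has colour c and the colour d of the old twin is summed out.
  centre : ℕ → Fin m → Fin m → Carrier
  centre j c b = [ c ≢ b ] * ∑ᶜ λ d → [ b ≢ d ] * (x d * ([ c ≢ d ] * branch j c d))

  -- Counts first vertices different from c and d only if c ≠ d. At c = d the colour is subtracted
  -- twice; this value enters when the sum over d ≠ c is completed and its diagonal term taken away.
  avoiding : ℕ → Fin m → Fin m → Carrier
  avoiding k c d = P k - p k c - p k d

  branch≈avoiding : ∀ j c d → [ c ≢ d ] * branch j c d ≈ [ c ≢ d ] * avoiding j c d
  branch≈avoiding zero    c d = *-congˡ (solve 0 (con (+ 1) := con (+ 1) :- con (+ 0) :- con (+ 0)) refl)
  branch≈avoiding (suc j) c d = ∑-≢-≢ c d (p (suc j))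

  -- The first branch is read from the twins outwards, so that both branches become paths whose
  -- first vertex avoids the colours of the twins.
  ∑-p-centre : ∀ i j c → ∑ᶜ (λ b → p (suc i) b * centre j c b) ≈
               ∑ᶜ (λ d → [ c ≢ d ] * (x d * (avoiding (suc i) c d * avoiding j c d)))
  ∑-p-centre i j c = begin
    ∑ᶜ (λ b → p (suc i) b * centre j c b)
      ≈⟨ ∑-cong (allFin m) (λ b → trans (*-congˡ (sym (*-∑ _ (allFin m) _))) (sym (*-∑ _ (allFin m) _))) ⟩
    ∑ᶜ (λ b → ∑ᶜ λ d → p (suc i) b * ([ c ≢ b ] * ([ b ≢ d ] * (x d * ([ c ≢ d ] * branch j c d)))))
      ≈⟨ ∑-swap (allFin m) (allFin m) _ ⟩
    ∑ᶜ (λ d → ∑ᶜ λ b → p (suc i) b * ([ c ≢ b ] * ([ b ≢ d ] * (x d * ([ c ≢ d ] * branch j c d)))))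
      ≈⟨ ∑-cong (allFin m) (λ d → ∑-cong (allFin m) λ b → trans
           (*-congˡ (*-congˡ (*-congʳ (reflexive (≢-sym b d)))))
           (solve 5 (λ q n n′ y z → q :* (n :* (n′ :* (y :* z))) := (y :* z) :* (n′ :* (n :* q))) refl _ _ _ _ _)) ⟩
    ∑ᶜ (λ d → ∑ᶜ λ b → (x d * ([ c ≢ d ] * branch j c d)) * ([ d ≢ b ] * ([ c ≢ b ] * p (suc i) b)))
      ≈⟨ ∑-cong (allFin m) (λ d → *-∑ _ (allFin m) _) ⟩
    ∑ᶜ (λ d → (x d * ([ c ≢ d ] * branch j c d)) * ∑ᶜ λ b → [ d ≢ b ] * ([ c ≢ b ] * p (suc i) b))
      ≈⟨ ∑-cong (allFin m) (λ d → trans (*-congʳ (*-congˡ (branch≈avoiding j c d)))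
           (solve 4 (λ y n r s → (y :* (n :* r)) :* s := y :* (r :* (n :* s))) refl _ _ _ _)) ⟩
    ∑ᶜ (λ d → x d * (avoiding j c d * ([ c ≢ d ] * ∑ᶜ λ b → [ d ≢ b ] * ([ c ≢ b ] * p (suc i) b))))
      ≈⟨ ∑-cong (allFin m) (λ d → trans (*-congˡ (*-congˡ (∑-≢-≢ c d (p (suc i)))))
           (solve 4 (λ y n r s → y :* (r :* (n :* s)) := n :* (y :* (s :* r))) refl _ _ _ _)) ⟩
    ∑ᶜ (λ d → [ c ≢ d ] * (x d * (avoiding (suc i) c d * avoiding j c d))) ∎

  ∑-avoiding : ∀ i j c → ∑ᶜ (λ d → x d * (avoiding i c d * avoiding j c d)) ≈
    (P i - p i c) * (P j - p j c) * P 1 - (P j - p j c) * (P 1 * P i - P (suc i))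
      - (P i - p i c) * (P 1 * P j - P (suc j))
      + (P i * (P 1 * P j - P (suc j)) - (P (suc i) * P j - P (suc i ℕ.+ j)))
  ∑-avoiding i j c = begin
    ∑ᶜ (λ d → x d * (avoiding i c d * avoiding j c d))
      ≈⟨ ∑-cong (allFin m) (λ d → solve 5 (λ y a b q r →
           y :* ((a :- q) :* (b :- r)) := a :* b :* y :- b :* (y :* q) :- a :* (y :* r) :+ y :* (q :* r)) refl _ A B _ _) ⟩
    ∑ᶜ (λ d → A * B * x d - B * (x d * p i d) - A * (x d * p j d) + x d * (p i d * p j d))
      ≈⟨ trans (∑-+ (allFin m) _ _) (+-congʳ (trans (∑-- (allFin m) _ _) (+-congʳ (∑-- (allFin m) _ _)))) ⟩
    ∑ᶜ (λ d → A * B * x d) - ∑ᶜ (λ d → B * (x d * p i d)) - ∑ᶜ (λ d → A * (x d * p j d)) + ∑ᶜ (λ d → x d * (p i d * p j d))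
      ≈⟨ +-cong (+-cong (+-cong
           (trans (*-∑ _ (allFin m) _) (*-congˡ ∑-x))
           (-‿cong (trans (*-∑ _ (allFin m) _) (*-congˡ (∑-x-p i)))))
           (-‿cong (trans (*-∑ _ (allFin m) _) (*-congˡ (∑-x-p j)))))
           (∑-x-p-p i j) ⟩
    A * B * P 1 - B * (P 1 * P i - P (suc i)) - A * (P 1 * P j - P (suc j))
      + (P i * (P 1 * P j - P (suc j)) - (P (suc i) * P j - P (suc i ℕ.+ j))) ∎
    where
    A = P i - p i c
    B = P j - p j c

  twinTotal : ℕ → ℕ → Carrier
  twinTotal i j = ∑ᶜ λ c → x c * ∑ᶜ λ a → x a * transfer^ i (centre j c) a

  twinTotal≈ : ∀ i j → twinTotal i j ≈ twinFormula P (suc i) j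
  twinTotal≈ i j = begin
    twinTotal i j
      -- The factor 1 inserted here is u 0 a, which lets `∑-transfer^` turn the first branch around;
      -- `∑-≢` then separates the diagonal d = c.
      ≈⟨ ∑-cong (allFin m) (λ c → *-congˡ (trans
           (∑-cong (allFin m) λ a → *-congˡ (sym (*-identityˡ _)))
           (trans (∑-transfer^ 0 i (centre j c)) (trans (∑-cong (allFin m) λ a → sym (*-assoc _ _ _)) (trans (∑-p-centre i j c)
           (trans (∑-≢ c _) (+-congʳ (∑-avoiding k j c)))))))) ⟩
    ∑ᶜ (λ c → x c * ((P k - p k c) * (P j - p j c) * P 1 - (P j - p j c) * Xᵢ - (P k - p k c) * Xⱼ + Xᵢⱼ
                     - x c * (avoiding k c c * avoiding j c c)))
      -- The diagonal term has two factors x c, one for each branch: x c * (P k - 2 p k c) = 2 p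
      -- (suc k) c - P k * p 1 c by `p-suc`. The literal factor 1 matches p 1 c = x c * u 0 c.
      ≈⟨ ∑-cong (allFin m) (λ c → trans (solve 9 (λ y a b q r s u v w →
           y :* ((a :- q) :* (b :- r) :* s :- (b :- r) :* u :- (a :- q) :* v :+ w :- y :* ((a :- q :- q) :* (b :- r :- r)))
           :=
           y :* (a :* b :* s :- b :* u :- a :* v :+ w) :- (y :* q) :* (b :* s :- v) :- (y :* r) :* (a :* s :- u) :+ (y :* (q :* r)) :* s
             :- (((y :* a :- y :* q) :+ (y :* a :- y :* q) :- a :* (y :* con (+ 1))) :* ((y :* b :- y :* r) :+ (y :* b :- y :* r) :- b :* (y :* con (+ 1)))))
           refl (x c) (P k) (P j) (p k c) (p j c) (P 1) Xᵢ Xⱼ Xᵢⱼ)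
         (+-congˡ (-‿cong (*-cong (+-congʳ (+-cong (sym (p-suc k c)) (sym (p-suc k c)))) (+-congʳ (+-cong (sym (p-suc j c)) (sym (p-suc j c)))))))) ⟩
    ∑ᶜ (λ c → x c * K - (x c * p k c) * L - (x c * p j c) * M + (x c * (p k c * p j c)) * P 1
              - (p (suc k) c + p (suc k) c - P k * p 1 c) * (p (suc j) c + p (suc j) c - P j * p 1 c))
      ≈⟨ trans (∑-- (allFin m) _ _) (+-cong (trans (∑-+ (allFin m) _ _) (+-cong (trans (∑-- (allFin m) _ _) (+-cong (trans (∑-- (allFin m) _ _)
           (+-cong (trans (∑-* (allFin m) _ _) (*-congʳ ∑-x))
             (-‿cong (trans (∑-* (allFin m) _ _) (*-congʳ (∑-x-p k))))))
             (-‿cong (trans (∑-* (allFin m) _ _) (*-congʳ (∑-x-p j))))))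
             (trans (∑-* (allFin m) _ _) (*-congʳ (∑-x-p-p k j)))))
             (-‿cong diagonal)) ⟩
    P 1 * K - Xᵢ * L - Xⱼ * M + Xᵢⱼ * P 1
      - (four (P (suc k) * P (suc j) - P (suc k ℕ.+ suc j)) - two (P j * (P 1 * P (suc k) - P (suc (suc k))))
         - two (P k * (P 1 * P (suc j) - P (suc (suc j)))) + P k * P j * (P 1 * P 1 - P 2))
      ≡⟨ ≡.cong (λ n → P 1 * K - Xᵢ * L - Xⱼ * M + Xᵢⱼ * P 1
      - (four (P (suc k) * P (suc j) - P n) - two (P j * (P 1 * P (suc k) - P (suc (suc k))))
         - two (P k * (P 1 * P (suc j) - P (suc (suc j)))) + P k * P j * (P 1 * P 1 - P 2))) (ℕ.+-suc (suc k) j) ⟩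
    _
      ≈⟨ solve 10 (λ P₁ P₂ a b a′ b′ a″ b″ n N →
           let Xi = P₁ :* a :- a′
               Xj = P₁ :* b :- b′
               Xij = a :* Xj :- (a′ :* b :- n)
               t = λ y → y :+ y
               half = N :+ N :+ P₁ :* n :- a′ :* b′ :- a :* b″ :- a″ :* b
           in P₁ :* (a :* b :* P₁ :- b :* Xi :- a :* Xj :+ Xij) :- Xi :* (b :* P₁ :- Xj) :- Xj :* (a :* P₁ :- Xi) :+ Xij :* P₁
              :- (t (t (a′ :* b′ :- N)) :- t (b :* (P₁ :* a′ :- a″)) :- t (a :* (P₁ :* b′ :- b″)) :+ a :* b :* (P₁ :* P₁ :- P₂))
              := half :+ half :+ a :* P₂ :* b)
           refl (P 1) (P 2) (P k) (P j) (P (suc k)) (P (suc j)) (P (suc (suc k))) (P (suc (suc j))) (P (suc k ℕ.+ j)) (P (suc (suc k ℕ.+ j))) ⟩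
    _ ∎
    where
    k = suc i
    Xᵢ = P 1 * P k - P (suc k)
    Xⱼ = P 1 * P j - P (suc j)
    Xᵢⱼ = P k * (P 1 * P j - P (suc j)) - (P (suc k) * P j - P (suc k ℕ.+ j))
    K = P k * P j * P 1 - P j * Xᵢ - P k * Xⱼ + Xᵢⱼ
    L = P j * P 1 - Xⱼ
    M = P k * P 1 - Xᵢ
    two four : Carrier → Carrier
    two y = y + y
    four y = two (two y)
    diagonal : ∑ᶜ (λ c → (p (suc k) c + p (suc k) c - P k * p 1 c) * (p (suc j) c + p (suc j) c - P j * p 1 c)) ≈
      four (P (suc k) * P (suc j) - P (suc k ℕ.+ suc j)) - two (P j * (P 1 * P (suc k) - P (suc (suc k))))
         - two (P k * (P 1 * P (suc j) - P (suc (suc j)))) + P k * P j * (P 1 * P 1 - P 2)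
    diagonal = begin
      ∑ᶜ (λ c → (p (suc k) c + p (suc k) c - P k * p 1 c) * (p (suc j) c + p (suc j) c - P j * p 1 c))
        ≈⟨ ∑-cong (allFin m) (λ c → solve 5 (λ q r y a b → (q :+ q :- a :* y) :* (r :+ r :- b :* y) :=
             con (+ 4) :* (q :* r) :- (b :+ b) :* (y :* q) :- (a :+ a) :* (y :* r) :+ a :* b :* (y :* y)) refl _ _ _ _ _) ⟩
      ∑ᶜ (λ c → (1# + 1# + 1# + 1#) * (p (suc k) c * p (suc j) c) - (P j + P j) * (p 1 c * p (suc k) c) - (P k + P k) * (p 1 c * p (suc j) c)
                + P k * P j * (p 1 c * p 1 c))
        ≈⟨ trans (∑-+ (allFin m) _ _) (+-cong (trans (∑-- (allFin m) _ _) (+-cong (trans (∑-- (allFin m) _ _) (+-cong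
            (trans (*-∑ _ (allFin m) _) (*-congˡ (∑-p-p (suc k) (suc j))))
            (-‿cong (trans (*-∑ _ (allFin m) _) (*-congˡ (∑-p-p 1 (suc k)))))))
            (-‿cong (trans (*-∑ _ (allFin m) _) (*-congˡ (∑-p-p 1 (suc j)))))))
            (trans (*-∑ _ (allFin m) _) (*-congˡ (∑-p-p 1 1)))) ⟩
      _
        ≈⟨ solve 6 (λ s t u v a b → con (+ 4) :* s :- (b :+ b) :* t :- (a :+ a) :* u :+ a :* b :* v
             := ((s :+ s) :+ (s :+ s)) :- (b :* t :+ b :* t) :- (a :* u :+ a :* u) :+ a :* b :* v) refl _ _ _ _ _ _ ⟩
      _ ∎

-- The generating function of the elementary symmetric functions, and Carlitz's formula.

module Elementary {c ℓ} (R : CommutativeRing c ℓ) where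

  open CommutativeRing R hiding (zero)
  open PowerSeries R
  private module S = CommutativeRing seriesRing
  open Algebra.Properties.Semiring.Mult semiring using (×-comm-*; ×-congʳ) renaming (_×_ to _•_)
  open Algebra.Properties.CommutativeMonoid.Mult +-commutativeMonoid using (×-distrib-+)
  open Relation.Binary.Reasoning.Setoid setoid

  linear : Carrier → Series
  linear y 1 = y
  linear y _ = 0#

  linear-⊛-head : ∀ y F → (linear y ⊛ F) 0 ≈ 0#
  linear-⊛-head y F = trans (⊛-head (linear y) F) (zeroˡ _)

  linear-⊛-tail : ∀ y F n → (linear y ⊛ F) (suc n) ≈ y * F n
  linear-⊛-tail y F n = begin
    (linear y ⊛ F) (suc n)                       ≈⟨ ⊛-tail (linear y) F n ⟩
    0# * F (suc n) + (tail (linear y) ⊛ F) n     ≈⟨ +-cong (zeroˡ _) (⊛-cong {G = F} tail-linear (λ _ → refl) n) ⟩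
    0# + ((λ i → y * one i) ⊛ F) n               ≈⟨ +-identityˡ _ ⟩
    ((λ i → y * one i) ⊛ F) n                    ≈⟨ scale-⊛ y one F n ⟩
    y * (one ⊛ F) n                              ≈⟨ *-congˡ (⊛-identityˡ F n) ⟩
    y * F n                                      ∎
    where
    tail-linear : ∀ i → linear y (suc i) ≈ y * one i
    tail-linear zero    = sym (*-identityʳ y)
    tail-linear (suc i) = sym (zeroʳ y)

  -- The product of 1 + y z over the list, expanded one factor at a time.
  elementary : List Carrier → Series
  elementary []       = one
  elementary (y ∷ ys) = elementary ys S.+ linear y ⊛ elementary ys

  elementary-zero : ∀ y ys → elementary (y ∷ ys) 0 ≈ elementary ys 0
  elementary-zero y ys = trans (+-congˡ (linear-⊛-head y (elementary ys))) (+-identityʳ _)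

  elementary-suc : ∀ y ys n → elementary (y ∷ ys) (suc n) ≈ elementary ys (suc n) + y * elementary ys n
  elementary-suc y ys n = +-congˡ (linear-⊛-tail y (elementary ys) n)

  -- z d/dz
  θ : Series → Series
  θ F n = n • F n

  -- The Leibniz rule for (1 + y z) E.
  θ-elementary : ∀ y ys → let E = elementary ys in
                 θ (elementary (y ∷ ys)) ≋ linear y ⊛ E S.+ (θ E S.+ linear y ⊛ θ E)
  θ-elementary y ys zero    = sym (trans (+-cong (linear-⊛-head y (elementary ys)) (+-identityˡ _))
    (trans (+-identityˡ _) (linear-⊛-head y (θ (elementary ys)))))
  θ-elementary y ys (suc n) = begin
    suc n • elementary (y ∷ ys) (suc n)         ≈⟨ ×-congʳ (suc n) (elementary-suc y ys n) ⟩
    suc n • (E (suc n) + y * E n)               ≈⟨ ×-distrib-+ _ _ (suc n) ⟩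
    suc n • E (suc n) + suc n • (y * E n)       ≈⟨ +-congˡ (+-congˡ (×-comm-* n y (E n))) ⟨
    suc n • E (suc n) + (y * E n + y * θ E n)   ≈⟨ +-congˡ (+-cong (linear-⊛-tail y E n) (linear-⊛-tail y (θ E) n)) ⟨
    suc n • E (suc n) + ((linear y ⊛ E) (suc n) + (linear y ⊛ θ E) (suc n))
                                                ≈⟨ +-assoc _ _ _ ⟨
    suc n • E (suc n) + (linear y ⊛ E) (suc n) + (linear y ⊛ θ E) (suc n)
                                                ≈⟨ +-congʳ (+-comm _ _) ⟩
    (linear y ⊛ E) (suc n) + suc n • E (suc n) + (linear y ⊛ θ E) (suc n)
                                                ≈⟨ +-assoc _ _ _ ⟩
    (linear y ⊛ E) (suc n) + (suc n • E (suc n) + (linear y ⊛ θ E) (suc n)) ∎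
    where E = elementary ys

module Carlitz {c ℓ} (R : CommutativeRing c ℓ) {m : ℕ} (x : Fin m → CommutativeRing.Carrier R) where

  open CommutativeRing R hiding (zero)
  open PowerSeries R
  private module S = CommutativeRing seriesRing
  open ListSum R
  open ListSum seriesRing using () renaming (∑ to ∑ₛ)
  open Elementary R
  open PathSum R x
  open Solver seriesRing
  open Relation.Binary.Reasoning.Setoid S.setoid

  pₛ : Fin m → Series
  pₛ c k = p k c

  linear-pₛ : ∀ c → pₛ c S.+ linear (x c) ⊛ pₛ c ≋ linear (x c) ⊛ P
  linear-pₛ c zero    = trans (+-identityˡ _) (trans (linear-⊛-head (x c) (pₛ c)) (sym (linear-⊛-head (x c) P)))
  linear-pₛ c (suc n) =
    trans (+-cong (p-suc n c) (linear-⊛-tail (x c) (pₛ c) n))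
    (trans (+-assoc _ _ _)
    (trans (+-congˡ (-‿inverseˡ _))
    (trans (+-identityʳ _)
    (sym (linear-⊛-tail (x c) P n)))))

  ∑ₛ-coefficient : ∀ {a} {A : Set a} (as : List A) (F : A → Series) n → ∑ₛ as F n ≡ ∑ as (λ a → F a n)
  ∑ₛ-coefficient []       F n = ≡.refl
  ∑ₛ-coefficient (a ∷ as) F n = ≡.cong (λ y → F a n + y) (∑ₛ-coefficient as F n)

  P≋1+∑p : P ≋ one S.+ ∑ₛ (allFin m) pₛ
  P≋1+∑p zero    = sym (trans (+-congˡ (trans (reflexive (∑ₛ-coefficient (allFin m) pₛ 0)) (∑-zero (allFin m)))) (+-identityʳ _))
  P≋1+∑p (suc n) = sym (trans (+-identityˡ _) (reflexive (∑ₛ-coefficient (allFin m) pₛ (suc n))))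

  -- By `linear-pₛ` the factor 1 + x c z turns `pₛ c` into x c z P, leaving the other factors; the
  -- sum of these products is the Leibniz expansion of θ. P stays the series for all m colours while
  -- cs shrinks.
  ∑ₛ-pₛ : ∀ cs → ∑ₛ cs pₛ ⊛ elementary (map x cs) ≋ P ⊛ θ (elementary (map x cs))
  ∑ₛ-pₛ []       = begin
    S.0# ⊛ one             ≈⟨ S.zeroˡ one ⟩
    S.0#                   ≈⟨ S.zeroʳ P ⟨
    P ⊛ S.0#               ≈⟨ ⊛-cong {F = P} (λ _ → refl) θ-one ⟨
    P ⊛ θ one              ∎
    where
    open Algebra.Properties.Semiring.Mult semiring using () renaming (_×_ to _•_)
    •-zero : ∀ n → n • 0# ≈ 0#
    •-zero zero    = refl
    •-zero (suc n) = trans (+-identityˡ _) (•-zero n)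
    θ-one : θ one ≋ S.0#
    θ-one zero    = refl
    θ-one (suc n) = •-zero (suc n)
  ∑ₛ-pₛ (c ∷ cs) = begin
    (pₛ c S.+ ∑ₛ cs pₛ) ⊛ (E S.+ l ⊛ E)
      ≈⟨ solve 4 (λ q s l E → (q :+ s) :* (E :+ l :* E) := (q :+ l :* q) :* E :+ (s :* E :+ l :* (s :* E))) S.refl (pₛ c) (∑ₛ cs pₛ) l E ⟩
    (pₛ c S.+ l ⊛ pₛ c) ⊛ E S.+ (∑ₛ cs pₛ ⊛ E S.+ l ⊛ (∑ₛ cs pₛ ⊛ E))
      ≈⟨ S.+-cong (S.*-congʳ (linear-pₛ c)) (S.+-cong (∑ₛ-pₛ cs) (S.*-congˡ (∑ₛ-pₛ cs))) ⟩
    (l ⊛ P) ⊛ E S.+ (P ⊛ θ E S.+ l ⊛ (P ⊛ θ E))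
      ≈⟨ solve 4 (λ l P E D → l :* P :* E :+ (P :* D :+ l :* (P :* D)) := P :* (l :* E :+ (D :+ l :* D))) S.refl l P E (θ E) ⟩
    P ⊛ (l ⊛ E S.+ (θ E S.+ l ⊛ θ E))
      ≈⟨ S.*-congˡ (θ-elementary (x c) (map x cs)) ⟨
    P ⊛ θ (elementary (map x (c ∷ cs))) ∎
    where
    E = elementary (map x cs)
    l = linear (x c)

  carlitz : let E = elementary (map x (allFin m)) in P ⊛ E ≋ E S.+ P ⊛ θ E
  carlitz = begin
    P ⊛ E                                     ≈⟨ S.*-congʳ P≋1+∑p ⟩
    (one S.+ ∑ₛ (allFin m) pₛ) ⊛ E            ≈⟨ S.distribʳ E one (∑ₛ (allFin m) pₛ) ⟩
    one ⊛ E S.+ ∑ₛ (allFin m) pₛ ⊛ E          ≈⟨ S.+-cong (S.*-identityˡ E) (∑ₛ-pₛ (allFin m)) ⟩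
    E S.+ P ⊛ θ E                             ∎
    where E = elementary (map x (allFin m))

  -- Adding Q - Q ⊛ e to both sides of `carlitz` gives a recursion for Q, without any division. The
  -- three series are fixed only up to `≋`, so that those of the theorem can be substituted.
  carlitz-recursion : ∀ {Q e G} → Q ≋ P → e ≋ elementary (map x (allFin m)) → G ≋ θ e S.- e S.+ one →
                      Q ≋ e S.+ Q ⊛ G
  carlitz-recursion {Q} {e} {G} Q≋P e≋E G≋ = begin
    Q
      ≈⟨ solve 2 (λ Q e → Q := Q :* e :- Q :* e :+ Q) S.refl Q e ⟩
    Q ⊛ e S.- Q ⊛ e S.+ Q
      ≈⟨ S.+-congʳ {Q} (S.+-congʳ {S.- (Q ⊛ e)} (S.trans (S.*-cong Q≋P e≋E) carlitz)) ⟩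
    (E S.+ P ⊛ θ E) S.- Q ⊛ e S.+ Q
      ≈⟨ S.+-congʳ {Q} (S.+-congʳ {S.- (Q ⊛ e)} (S.+-cong e≋E (S.*-cong Q≋P (λ n → ×-congʳ n (e≋E n))))) ⟨
    (e S.+ Q ⊛ θ e) S.- Q ⊛ e S.+ Q
      ≈⟨ solve 3 (λ Q e D → (e :+ Q :* D) :- Q :* e :+ Q := e :+ Q :* (D :- e :+ con (+ 1))) S.refl Q e (θ e) ⟩
    e S.+ Q ⊛ (θ e S.- e S.+ one)
      ≈⟨ S.+-congˡ {e} (S.*-congˡ {Q} G≋) ⟨
    e S.+ Q ⊛ G ∎
    where
    E = elementary (map x (allFin m))
    open Algebra.Properties.Semiring.Mult semiring using (×-congʳ)

-- Proper colourings of paths and twinned paths, vertex by vertex.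

Proper-path-∷ : ∀ {n m} (c d : Fin m) (κ : Vec (Fin m) n) →
                Proper (path (suc (suc n))) (c ∷ d ∷ κ) ⇔ (c ≢ d × Proper (path (suc n)) (d ∷ κ))
Proper-path-∷ {n} c d κ = mk⇔ to λ (c≢d , proper) → from c≢d proper
  where
  to : Proper (path (suc (suc n))) (c ∷ d ∷ κ) → c ≢ d × Proper (path (suc n)) (d ∷ κ)
  to proper = proper zero (suc zero) (inj₁ ≡.refl)
            , λ where u v (inj₁ e) → proper (suc u) (suc v) (inj₁ (≡.cong suc e))
                      u v (inj₂ e) → proper (suc u) (suc v) (inj₂ (≡.cong suc e))
  from : c ≢ d → Proper (path (suc n)) (d ∷ κ) → Proper (path (suc (suc n))) (c ∷ d ∷ κ)
  from c≢d proper zero             zero             (inj₁ ())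
  from c≢d proper zero             zero             (inj₂ ())
  from c≢d proper zero             (suc zero)       _        = c≢d
  from c≢d proper zero             (suc (suc v))    (inj₁ ())
  from c≢d proper zero             (suc (suc v))    (inj₂ ())
  from c≢d proper (suc zero)       zero             _        = c≢d ∘ ≡.sym
  from c≢d proper (suc (suc u))    zero             (inj₁ ())
  from c≢d proper (suc (suc u))    zero             (inj₂ ())
  from c≢d proper (suc u)          (suc v)          (inj₁ e) = proper u v (inj₁ (ℕ.suc-injective e))
  from c≢d proper (suc u)          (suc v)          (inj₂ e) = proper u v (inj₂ (ℕ.suc-injective e))

-- The condition on the colour c of the new vertex, whose neighbours form the closed neighbourhood
-- of v.
Apart : ∀ {n m} → Graph n → Fin n → Fin m → Vec (Fin m) n → Set
Apart H v c κ = ∀ u → u ≡ v ⊎ Graph.Adj H u v → c ≢ lookup κ u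

Proper-twin : ∀ {n m} (H : Graph n) v (c : Fin m) κ →
              Proper (twin H v) (c ∷ κ) ⇔ (Apart H v c κ × Proper H κ)
Proper-twin H v c κ = mk⇔ (λ proper → (λ u → proper zero (suc u)) , (λ u w → proper (suc u) (suc w)))
                          λ (apart , proper) → from apart proper
  where
  from : Apart H v c κ → Proper H κ → Proper (twin H v) (c ∷ κ)
  from apart proper zero    (suc u) adj = apart u adj
  from apart proper (suc u) zero    adj = apart u adj ∘ ≡.sym
  from apart proper (suc u) (suc w) adj = proper u w adj

Apart-path-single : ∀ {m} (c d : Fin m) → Apart (path 1) zero c (d ∷ []) ⇔ c ≢ d
Apart-path-single c d = mk⇔ (λ apart → apart zero (inj₁ ≡.refl)) λ { c≢d zero _ → c≢d }

Apart-path-zero : ∀ {n m} (c d e : Fin m) (κ : Vec (Fin m) n) →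
                  Apart (path (suc (suc n))) zero c (d ∷ e ∷ κ) ⇔ (c ≢ d × c ≢ e)
Apart-path-zero {n} c d e κ = mk⇔ (λ apart → apart zero (inj₁ ≡.refl) , apart (suc zero) (inj₂ (inj₂ ≡.refl)))
                              λ (c≢d , c≢e) → from c≢d c≢e
  where
  from : c ≢ d → c ≢ e → Apart (path (suc (suc n))) zero c (d ∷ e ∷ κ)
  from c≢d c≢e zero          _                = c≢d
  from c≢d c≢e (suc zero)    _                = c≢e
  from c≢d c≢e (suc (suc u)) (inj₁ ())
  from c≢d c≢e (suc (suc u)) (inj₂ (inj₁ ()))
  from c≢d c≢e (suc (suc u)) (inj₂ (inj₂ ()))

closed-path-pred : ∀ {n} (u v : Fin n) → suc u ≡ suc v ⊎ Graph.Adj (path (suc n)) (suc u) (suc v) →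
                   u ≡ v ⊎ Graph.Adj (path n) u v
closed-path-pred u v (inj₁ e)        = inj₁ (Fin.suc-injective e)
closed-path-pred u v (inj₂ (inj₁ e)) = inj₂ (inj₁ (ℕ.suc-injective e))
closed-path-pred u v (inj₂ (inj₂ e)) = inj₂ (inj₂ (ℕ.suc-injective e))

Apart-path-tail : ∀ {n m} {v} {c a : Fin m} {κ : Vec (Fin m) n} →
                  Apart (path (suc n)) (suc v) c (a ∷ κ) → Apart (path n) v c κ
Apart-path-tail apart u (inj₁ e)        = apart (suc u) (inj₁ (≡.cong suc e))
Apart-path-tail apart u (inj₂ (inj₁ e)) = apart (suc u) (inj₂ (inj₁ (≡.cong suc e)))
Apart-path-tail apart u (inj₂ (inj₂ e)) = apart (suc u) (inj₂ (inj₂ (≡.cong suc e)))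

Apart-path-one : ∀ {n m} (c a : Fin m) (κ : Vec (Fin m) (suc n)) →
                 Apart (path (suc (suc n))) (suc zero) c (a ∷ κ) ⇔ (c ≢ a × Apart (path (suc n)) zero c κ)
Apart-path-one {n} c a κ = mk⇔ (λ apart → apart zero (inj₂ (inj₁ ≡.refl)) , Apart-path-tail apart)
                           λ (c≢a , apart) → λ where
                             zero    _   → c≢a
                             (suc u) adj → apart u (closed-path-pred u zero adj)

Apart-path-suc : ∀ {n m} v (c a : Fin m) (κ : Vec (Fin m) (suc n)) →
                 Apart (path (suc (suc n))) (suc (suc v)) c (a ∷ κ) ⇔ Apart (path (suc n)) (suc v) c κ
Apart-path-suc {n} v c a κ = mk⇔ Apart-path-tail λ apart → λ where
                             zero    (inj₂ (inj₁ ()))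
                             zero    (inj₂ (inj₂ ()))
                             (suc u) adj → apart u (closed-path-pred u (suc v) adj)

Proper-twin-single : ∀ {m} (c d : Fin m) → Proper (twin (path 1) zero) (c ∷ d ∷ []) ⇔ c ≢ d
Proper-twin-single c d = mk⇔
  (λ proper → to (Apart-path-single c d) (proj₁ (to (Proper-twin _ _ c (d ∷ [])) proper)))
  (λ c≢d → from (Proper-twin _ _ c (d ∷ [])) (from (Apart-path-single c d) c≢d , λ { zero zero (inj₁ ()) ; zero zero (inj₂ ()) }))
  where open Equivalence

Proper-twin-zero : ∀ {n m} (c d e : Fin m) (κ : Vec (Fin m) n) →
  Proper (twin (path (suc (suc n))) zero) (c ∷ d ∷ e ∷ κ) ⇔
  ((c ≢ d × c ≢ e) × (d ≢ e × Proper (path (suc n)) (e ∷ κ)))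
Proper-twin-zero c d e κ = mk⇔
  (λ proper → let (apart , proper′) = to (Proper-twin _ zero c (d ∷ e ∷ κ)) proper in
     to (Apart-path-zero c d e κ) apart , to (Proper-path-∷ d e κ) proper′)
  (λ (apart , proper) → from (Proper-twin _ zero c (d ∷ e ∷ κ))
     (from (Apart-path-zero c d e κ) apart , from (Proper-path-∷ d e κ) proper))
  where open Equivalence

-- The deleted vertex a is the neighbour of the twinned vertex b, so both twins constrain it.
Proper-twin-one : ∀ {n m} (c a b : Fin m) (κ : Vec (Fin m) n) →
  Proper (twin (path (suc (suc n))) (suc zero)) (c ∷ a ∷ b ∷ κ) ⇔
  ((c ≢ a × a ≢ b) × Proper (twin (path (suc n)) zero) (c ∷ b ∷ κ))
Proper-twin-one c a b κ = mk⇔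
  (λ proper → let (apart , proper₁) = to (Proper-twin _ (suc zero) c (a ∷ b ∷ κ)) proper
                  (c≢a , apart′)    = to (Apart-path-one c a (b ∷ κ)) apart
                  (a≢b , proper₂)   = to (Proper-path-∷ a b κ) proper₁
              in (c≢a , a≢b) , from (Proper-twin _ zero c (b ∷ κ)) (apart′ , proper₂))
  (λ ((c≢a , a≢b) , proper) → let (apart , proper₂) = to (Proper-twin _ zero c (b ∷ κ)) proper in
     from (Proper-twin _ (suc zero) c (a ∷ b ∷ κ))
       (from (Apart-path-one c a (b ∷ κ)) (c≢a , apart) , from (Proper-path-∷ a b κ) (a≢b , proper₂)))
  where open Equivalence

-- The deleted vertex a is not adjacent to the twins; only its successor b on the path constrains
-- it.
Proper-twin-suc : ∀ {n m} v (c a b : Fin m) (κ : Vec (Fin m) n) →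
  Proper (twin (path (suc (suc n))) (suc (suc v))) (c ∷ a ∷ b ∷ κ) ⇔
  (a ≢ b × Proper (twin (path (suc n)) (suc v)) (c ∷ b ∷ κ))
Proper-twin-suc v c a b κ = mk⇔
  (λ proper → let (apart , proper₁) = to (Proper-twin _ (suc (suc v)) c (a ∷ b ∷ κ)) proper
                  (a≢b , proper₂)   = to (Proper-path-∷ a b κ) proper₁
              in a≢b , from (Proper-twin _ (suc v) c (b ∷ κ)) (to (Apart-path-suc v c a (b ∷ κ)) apart , proper₂))
  (λ (a≢b , proper) → let (apart , proper₂) = to (Proper-twin _ (suc v) c (b ∷ κ)) proper in
     from (Proper-twin _ (suc (suc v)) c (a ∷ b ∷ κ))
       (from (Apart-path-suc v c a (b ∷ κ)) apart , from (Proper-path-∷ a b κ) (a≢b , proper₂)))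
  where open Equivalence

-- Weighted sums over proper colourings as transfer products.

module ChromaticSum {c ℓ} (R : CommutativeRing c ℓ) {m : ℕ} (x : Fin m → CommutativeRing.Carrier R) where

  open CommutativeRing R hiding (zero)
  open ListSum R
  open Indicator R
  open PathSum R x
  open TwinSum R x
  open TwinFormula R
  open Solver R
  open Relation.Binary.Reasoning.Setoid setoid

  weight : ∀ {n} → Vec (Fin m) n → Carrier
  weight []      = 1#
  weight (c ∷ κ) = x c * weight κ

  chromatic : ∀ {n} → Graph n → Carrier
  chromatic {n} H = ∑ (colourings n m) λ κ → ind (proper? H κ) * weight κ

  ∑-colourings-suc : ∀ n (g : Vec (Fin m) (suc n) → Carrier) →
                     ∑ (colourings (suc n) m) g ≈ ∑ᶜ (λ c → ∑ (colourings n m) λ κ → g (c ∷ κ))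
  ∑-colourings-suc n g = trans (∑-concatMap _ (allFin m) g)
    (∑-cong (allFin m) λ c → reflexive (∑-map (c ∷_) (colourings n m) g))

  -- k c collects the conditions on the first colour given the earlier ones, and h c those passed on
  -- to the remaining vertices.
  ∑-colourings-∷ : ∀ n (g : Vec (Fin m) (suc n) → Carrier) (k : Fin m → Carrier) (h : Fin m → Vec (Fin m) n → Carrier) →
    (∀ c κ → g (c ∷ κ) ≈ k c * h c κ) →
    ∑ (colourings (suc n) m) (λ κ → g κ * weight κ) ≈ ∑ᶜ (λ c → k c * (x c * ∑ (colourings n m) λ κ → h c κ * weight κ))
  ∑-colourings-∷ n g k h eq = trans (∑-colourings-suc n _) (∑-cong (allFin m) λ c → begin
    ∑ (colourings n m) (λ κ → g (c ∷ κ) * (x c * weight κ))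
      ≈⟨ ∑-cong (colourings n m) (λ κ → trans (*-congʳ (eq c κ))
           (solve 4 (λ a b y w → a :* b :* (y :* w) := a :* (y :* (b :* w))) refl _ _ _ _)) ⟩
    ∑ (colourings n m) (λ κ → k c * (x c * (h c κ * weight κ)))
      ≈⟨ trans (*-∑ _ (colourings n m) _) (*-congˡ (*-∑ _ (colourings n m) _)) ⟩
    k c * (x c * ∑ (colourings n m) λ κ → h c κ * weight κ) ∎)

  ind-⇔ : ∀ {a b} {A : Set a} {B : Set b} → A ⇔ B → (A? : Dec A) (B? : Dec B) → ind A? ≡ ind B?
  ind-⇔ A⇔B A? B? = ≡.cong (if_then 1# else 0#) (does-⇔ A⇔B A? B?)

  ind-× : ∀ {a b} {A : Set a} {B : Set b} (A? : Dec A) (B? : Dec B) → ind (A? ×-dec B?) ≈ ind A? * ind B?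
  ind-× A? B? with does A?
  ... | true  = sym (*-identityˡ _)
  ... | false = sym (zeroˡ _)

  _≢?_ : (c d : Fin m) → Dec (c ≢ d)
  c ≢? d = ¬? (c Fin.≟ d)

  path-from : ∀ n c → ∑ (colourings n m) (λ κ → ind (proper? (path (suc n)) (c ∷ κ)) * weight κ) ≈ u n c
  path-from zero    c = trans (+-identityʳ _) (trans (*-identityʳ _)
    (reflexive (≡.cong (if_then 1# else 0#) (dec-true (proper? (path 1) (c ∷ []))
      λ { zero zero (inj₁ ()) ; zero zero (inj₂ ()) }))))
  path-from (suc n) c = trans
    (∑-colourings-∷ n _ _ _ λ d κ → trans
      (reflexive (ind-⇔ (Proper-path-∷ c d κ) (proper? (path (suc (suc n))) (c ∷ d ∷ κ)) ((c ≢? d) ×-dec proper? (path (suc n)) (d ∷ κ))))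
      (ind-× (c ≢? d) (proper? (path (suc n)) (d ∷ κ))))
    (∑-cong (allFin m) λ d → *-congˡ (*-congˡ (path-from n d)))

  chromatic-path : ∀ n → chromatic (path n) ≈ P n
  chromatic-path zero    = trans (+-identityʳ _) (*-identityˡ _)
  chromatic-path (suc n) = trans
    (∑-colourings-∷ n _ (λ _ → 1#) _ λ c κ → sym (*-identityˡ _))
    (∑-cong (allFin m) λ c → trans (*-identityˡ _) (*-congˡ (path-from n c)))

  twin-from-zero : ∀ j c d →
    ∑ (colourings j m) (λ κ → ind (proper? (twin (path (suc j)) zero) (c ∷ d ∷ κ)) * weight κ) ≈ [ c ≢ d ] * branch j c d
  twin-from-zero zero    c d = trans (+-identityʳ _) (*-congʳ
    (reflexive (ind-⇔ (Proper-twin-single c d) (proper? (twin (path 1) zero) (c ∷ d ∷ [])) (c ≢? d))))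
  twin-from-zero (suc j) c d = begin
    ∑ (colourings (suc j) m) (λ κ → ind (proper? (twin (path (suc (suc j))) zero) (c ∷ d ∷ κ)) * weight κ)
      ≈⟨ ∑-colourings-∷ j _ _ _ (λ e κ → trans
           (reflexive (ind-⇔ (Proper-twin-zero c d e κ) (proper? (twin (path (suc (suc j))) zero) (c ∷ d ∷ e ∷ κ))
             (((c ≢? d) ×-dec (c ≢? e)) ×-dec ((d ≢? e) ×-dec proper? (path (suc j)) (e ∷ κ)))))
           (trans (ind-× ((c ≢? d) ×-dec (c ≢? e)) ((d ≢? e) ×-dec proper? (path (suc j)) (e ∷ κ)))
           (trans (*-cong (ind-× (c ≢? d) (c ≢? e)) (ind-× (d ≢? e) (proper? (path (suc j)) (e ∷ κ))))
           (sym (*-assoc _ _ _))))) ⟩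
    ∑ᶜ (λ e → [ c ≢ d ] * [ c ≢ e ] * [ d ≢ e ] * (x e * ∑ (colourings j m) λ κ → ind (proper? (path (suc j)) (e ∷ κ)) * weight κ))
      ≈⟨ ∑-cong (allFin m) (λ e → trans (*-congˡ (*-congˡ (path-from j e)))
           (solve 4 (λ p q r s → p :* q :* r :* s := p :* (r :* (q :* s))) refl _ _ _ _)) ⟩
    ∑ᶜ (λ e → [ c ≢ d ] * ([ d ≢ e ] * ([ c ≢ e ] * p (suc j) e)))
      ≈⟨ *-∑ _ (allFin m) _ ⟩
    [ c ≢ d ] * branch (suc j) c d ∎

  -- With i + 1 vertices before the twinned one and j after it, size and position are written so
  -- that both unfold in i when a vertex is deleted.
  twin-from-suc : ∀ i j c a →
    ∑ (colourings (i ℕ.+ suc j) m) (λ κ → ind (proper? (twin (path (suc i ℕ.+ suc j)) (suc i ↑ʳ zero)) (c ∷ a ∷ κ)) * weight κ) ≈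
    transfer^ i (centre j c) a
  twin-from-suc zero    j c a = begin
    ∑ (colourings (suc j) m) (λ κ → ind (proper? (twin (path (suc (suc j))) (suc zero)) (c ∷ a ∷ κ)) * weight κ)
      ≈⟨ ∑-colourings-∷ j _ _ _ (λ b κ → trans
           (reflexive (ind-⇔ (Proper-twin-one c a b κ) (proper? (twin (path (suc (suc j))) (suc zero)) (c ∷ a ∷ b ∷ κ))
             (((c ≢? a) ×-dec (a ≢? b)) ×-dec proper? (twin (path (suc j)) zero) (c ∷ b ∷ κ))))
           (trans (ind-× ((c ≢? a) ×-dec (a ≢? b)) (proper? (twin (path (suc j)) zero) (c ∷ b ∷ κ)))
           (*-congʳ (ind-× (c ≢? a) (a ≢? b))))) ⟩
    ∑ᶜ (λ b → [ c ≢ a ] * [ a ≢ b ] * (x b * ∑ (colourings j m) λ κ → ind (proper? (twin (path (suc j)) zero) (c ∷ b ∷ κ)) * weight κ))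
      ≈⟨ ∑-cong (allFin m) (λ b → trans (*-congˡ (*-congˡ (twin-from-zero j c b))) (*-assoc _ _ _)) ⟩
    ∑ᶜ (λ b → [ c ≢ a ] * ([ a ≢ b ] * (x b * ([ c ≢ b ] * branch j c b))))
      ≈⟨ *-∑ _ (allFin m) _ ⟩
    centre j c a ∎
  twin-from-suc (suc i) j c a = trans
    (∑-colourings-∷ (i ℕ.+ suc j) _ _ _ λ b κ → trans
      (reflexive (ind-⇔ (Proper-twin-suc (i ↑ʳ zero) c a b κ) (proper? (twin (path (suc (suc i) ℕ.+ suc j)) (suc (suc i) ↑ʳ zero)) (c ∷ a ∷ b ∷ κ))
        ((a ≢? b) ×-dec proper? (twin (path (suc i ℕ.+ suc j)) (suc i ↑ʳ zero)) (c ∷ b ∷ κ))))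
      (ind-× (a ≢? b) (proper? (twin (path (suc i ℕ.+ suc j)) (suc i ↑ʳ zero)) (c ∷ b ∷ κ))))
    (∑-cong (allFin m) λ b → *-congˡ (*-congˡ (twin-from-suc i j c b)))

  chromatic-twin : ∀ i j → chromatic (twin (path (suc i ℕ.+ suc j)) (suc i ↑ʳ zero)) ≈ twinTotal i j
  chromatic-twin i j = trans
    (∑-colourings-∷ (suc i ℕ.+ suc j) _ (λ _ → 1#) _ λ c κ → sym (*-identityˡ _))
    (∑-cong (allFin m) λ c → trans (*-identityˡ _) (*-congˡ (trans
      (∑-colourings-∷ (i ℕ.+ suc j) _ (λ _ → 1#) _ λ a κ → sym (*-identityˡ _))
      (∑-cong (allFin m) λ a → trans (*-identityˡ _) (*-congˡ (twin-from-suc i j c a))))))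

  chromatic-twin-formula : ∀ {Q y} i j → (∀ n → Q n ≈ P n) →
    y ≈ chromatic (twin (path (suc i ℕ.+ suc j)) (suc i ↑ʳ zero)) → y ≈ twinFormula Q (suc i) j
  chromatic-twin-formula {Q} i j Q≈P y≈ = trans y≈ (trans (chromatic-twin i j)
    (trans (twinTotal≈ i j) (sym (twinFormula-cong Q≈P (suc i) j))))

-- The ring of power series in m variables.

module ℤ∑ = ListSum ℤ.+-*-commutativeRing

sumˣ-coefficient : ∀ {a} {A : Set a} (as : List A) (F : A → ℤ⟦x⟧) α →
                   sumˣ (map F as) α ≡ ℤ∑.∑ as (λ a → F a α)
sumˣ-coefficient []       F α = ≡.refl
sumˣ-coefficient (a ∷ as) F α = ≡.cong (λ i → F a α ℤ.+ i) (sumˣ-coefficient as F α)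

-- Series are compared only at the monomials in the first m variables.
truncatedRawRing : ℕ → RawRing 0ℓ 0ℓ
truncatedRawRing m = record
  { Carrier = ℤ⟦x⟧
  ; _≈_ = λ F G → (α : Vec ℕ m) → F (toList α) ≡ G (toList α)
  ; _+_ = _+ˣ_
  ; _*_ = _*ˣ_
  ; -_  = -ˣ_
  ; 0#  = 0ˣ
  ; 1#  = 1ˣ
  }

-- Views a series in m + 1 variables as a series in the first variable over the series in the
-- remaining m.
curry : ℤ⟦x⟧ → ℕ → ℤ⟦x⟧
curry F a α = F (a ∷ α)

curry-* : ∀ F G a α → (F *ˣ G) (a ∷ α) ≡ sumˣ (map (λ i → curry F i *ˣ curry G (a ∸ i)) (upTo (suc a))) α
curry-* F G a α = begin
  (F *ˣ G) (a ∷ α)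
    ≡⟨ ℤ∑.∑-concatMap (λ i → map (λ (β , γ) → i ∷ β , (a ∸ i) ∷ γ) (splits α)) (upTo (suc a)) _ ⟩
  ℤ∑.∑ (upTo (suc a)) (λ i → ℤ∑.∑ (map (λ (β , γ) → i ∷ β , (a ∸ i) ∷ γ) (splits α)) (λ (β , γ) → F β ℤ.* G γ))
    ≡⟨ ℤ∑.∑-cong (upTo (suc a)) (λ i → ℤ∑.∑-map (λ (β , γ) → i ∷ β , (a ∸ i) ∷ γ) (splits α) _) ⟩
  ℤ∑.∑ (upTo (suc a)) (λ i → (curry F i *ˣ curry G (a ∸ i)) α)
    ≡⟨ sumˣ-coefficient (upTo (suc a)) (λ i → curry F i *ˣ curry G (a ∸ i)) α ⟨
  sumˣ (map (λ i → curry F i *ˣ curry G (a ∸ i)) (upTo (suc a))) α ∎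
  where open ≡.≡-Reasoning

constantTerm-isMonomorphism : IsRingMonomorphism (truncatedRawRing 0) ℤ.+-*-rawRing (λ F → F [])
constantTerm-isMonomorphism = record
  { isRingHomomorphism = record
    { isSemiringHomomorphism = record
      { isNearSemiringHomomorphism = record
        { +-isMonoidHomomorphism = record
          { isMagmaHomomorphism = record
            { isRelHomomorphism = record { cong = λ F≈G → F≈G [] }
            ; homo = λ F G → ≡.refl
            }
          ; ε-homo = ≡.refl
          }
        ; *-homo = λ F G → ℤ.+-identityʳ _
        }
      ; 1#-homo = ≡.refl
      }
    ; -‿homo = λ F → ≡.refl
    }
  ; injective = λ { F≡G [] → F≡G }
  }

-- The laws are pulled back along injective homomorphisms: the constant term into ℤ for m = 0, and
-- `curry` into the series ring over m variables for m + 1. The second needs the ring for m, hence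
-- the joint recursion.
truncated-isCommutativeRing : ∀ m → let open RawRing (truncatedRawRing m) in
                              IsCommutativeRing _≈_ _+_ _*_ -_ 0# 1#

truncatedRing : ℕ → CommutativeRing 0ℓ 0ℓ
truncatedRing m = record { isCommutativeRing = truncated-isCommutativeRing m }

curry-isMonomorphism : ∀ m → IsRingMonomorphism (truncatedRawRing (suc m))
  (CommutativeRing.rawRing (PowerSeries.seriesRing (truncatedRing m))) curry
curry-isMonomorphism m = record
  { isRingHomomorphism = record
    { isSemiringHomomorphism = record
      { isNearSemiringHomomorphism = record
        { +-isMonoidHomomorphism = record
          { isMagmaHomomorphism = record
            { isRelHomomorphism = record { cong = λ F≈G a α → F≈G (a ∷ α) }
            ; homo = λ F G a α → ≡.refl
            }
          ; ε-homo = λ a α → ≡.refl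
          }
        ; *-homo = λ F G a α → curry-* F G a (toList α)
        }
      ; 1#-homo = λ { zero α → ≡.refl ; (suc a) α → ≡.refl }
      }
    ; -‿homo = λ F a α → ≡.refl
    }
  ; injective = λ { F≋G (a ∷ α) → F≋G a α }
  }

truncated-isCommutativeRing zero    = Algebra.Morphism.RingMonomorphism.isCommutativeRing
  constantTerm-isMonomorphism (CommutativeRing.isCommutativeRing ℤ.+-*-commutativeRing)
truncated-isCommutativeRing (suc m) = Algebra.Morphism.RingMonomorphism.isCommutativeRing
  (curry-isMonomorphism m) (CommutativeRing.isCommutativeRing (PowerSeries.seriesRing (truncatedRing m)))

module Truncated (m : ℕ) where
  open CommutativeRing (truncatedRing m) public hiding (zero)
  open PowerSeries (truncatedRing m) public
  open ListSum (truncatedRing m) public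
  open Indicator (truncatedRing m) public
  open Elementary (truncatedRing m) public

-- Variables, monomials, chromatic and elementary symmetric functions in m variables.

constant : ℤ⟦x⟧ → ℕ → ℤ⟦x⟧
constant F zero    = F
constant F (suc a) = 0ˣ

constant-⊛ : ∀ m F G → let open Truncated m in constant F ⊛ G ≋ λ n → F * G n
constant-⊛ m F G zero    = ⊛-head (constant F) G
  where open Truncated m
constant-⊛ m F G (suc n) α = ≡.trans (⊛-tail (constant F) G n α)
  (≡.trans (≡.cong (λ i → (F * G (suc n)) (toList α) ℤ.+ i) (⊛-zeroˡ G n α)) (ℤ.+-identityʳ _))
  where open Truncated m

uncurry : (ℕ → ℤ⟦x⟧) → ℤ⟦x⟧
-- A default value: these series are compared only at lists with at least one entry.
uncurry F []      = 0ℤ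
uncurry F (a ∷ α) = F a α

lift : ℤ⟦x⟧ → ℤ⟦x⟧
lift F = uncurry (constant F)

var : ∀ {m} → Fin m → ℤ⟦x⟧
var {suc m} zero    = uncurry (Truncated.linear m 1ˣ)
var         (suc c) = lift (var c)

monomial : ∀ {m} → (Fin m → ℕ) → ℤ⟦x⟧
monomial {zero}  b = 1ˣ
monomial {suc m} b = uncurry λ a → if does (b zero ℕ.≟ a) then monomial (b ∘ suc) else 0ˣ

-- Has the shape to which `count` unfolds on c ∷ κ, so multiplying by a variable matches adding a
-- vertex without a further lemma.
incrementAt : ∀ {m} → Fin m → (Fin m → ℕ) → Fin m → ℕ
incrementAt c b d = (if does (c Fin.≟ d) then suc else id) (b d)

var-*-monomial : ∀ {m} (c : Fin m) b → let open Truncated m in var c * monomial b ≈ monomial (incrementAt c b)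
var-*-monomial {suc m} zero b (zero ∷ α) = ≡.trans
  (curry-* (var {suc m} zero) (monomial b) 0 (toList α)) (linear-⊛-head 1ˣ (curry (monomial b)) α)
  where open Truncated m
var-*-monomial {suc m} zero b (suc a ∷ α) = ≡.trans
  (curry-* (var {suc m} zero) (monomial b) (suc a) (toList α))
  (≡.trans (linear-⊛-tail 1ˣ (curry (monomial b)) a α) (*-identityˡ (curry (monomial b) a) α))
  where open Truncated m
var-*-monomial {suc m} (suc c) b (a ∷ α) = ≡.trans
  (curry-* (var (suc c)) (monomial b) a (toList α))
  (≡.trans (constant-⊛ m (var c) (curry (monomial b)) a α) (tail-case (does (b zero ℕ.≟ a))))
  where
  open Truncated m
  tail-case : ∀ t → (var c * (if t then monomial (b ∘ suc) else 0ˣ)) (toList α) ≡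
                    (if t then monomial (incrementAt c (b ∘ suc)) else 0ˣ) (toList α)
  tail-case true  = var-*-monomial c (b ∘ suc) α
  tail-case false = zeroʳ (var c) α

monomial-zero : ∀ m → let open Truncated m in monomial {m} (λ _ → 0) ≈ 1ˣ
monomial-zero zero    α             = ≡.refl
monomial-zero (suc m) (zero ∷ α)    = monomial-zero m α
monomial-zero (suc m) (suc a ∷ α)   = ≡.refl

indℤ : ∀ {a} {A : Set a} → Dec A → ℤ
indℤ A? = if does A? then 1ℤ else 0ℤ

monomial-coefficient : ∀ {m} (b : Fin m → ℕ) (α : Vec ℕ m) →
  indℤ (List.≡-dec ℕ._≟_ (map b (allFin m)) (toList α)) ≡ monomial b (toList α)
monomial-coefficient {zero}  b []      = ≡.refl
monomial-coefficient {suc m} b (a ∷ α) = ≡.trans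
  (≡.cong (λ β → if does (b zero ℕ.≟ a) ∧ does (List.≡-dec ℕ._≟_ β (toList α)) then 1ℤ else 0ℤ)
    (≡.trans (List.map-tabulate suc b) (≡.sym (List.map-tabulate id (b ∘ suc)))))
  (head-case (does (b zero ℕ.≟ a)))
  where
  head-case : ∀ t → (if t ∧ does (List.≡-dec ℕ._≟_ (map (b ∘ suc) (allFin m)) (toList α)) then 1ℤ else 0ℤ) ≡
                    (if t then monomial (b ∘ suc) else 0ˣ) (toList α)
  head-case true  = monomial-coefficient (b ∘ suc) α
  head-case false = ≡.refl

weight≈monomial : ∀ {n m} (κ : Vec (Fin m) n) → let open Truncated m; open ChromaticSum (truncatedRing m) var in
                  weight κ ≈ monomial (λ d → count (Fin._≟ d) κ)
weight≈monomial {m = m} []      α = ≡.sym (monomial-zero m α)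
weight≈monomial {m = m} (c ∷ κ) α = ≡.trans
  (*-congˡ {var c} {weight κ} {monomial counts} (weight≈monomial κ) α)
  (var-*-monomial c counts α)
  where
  open Truncated m
  open ChromaticSum (truncatedRing m) var
  counts : Fin m → ℕ
  counts d = count (Fin._≟ d) κ

length-filter : ∀ {a p} {A : Set a} {P : A → Set p} (P? : ∀ a → Dec (P a)) as →
                + length (filter P? as) ≡ ℤ∑.∑ as (λ a → indℤ (P? a))
length-filter P? []       = ≡.refl
length-filter P? (a ∷ as) with does (P? a)
... | false = ≡.trans (length-filter P? as) (≡.sym (ℤ.+-identityˡ _))
... | true  = ≡.cong (λ i → + 1 ℤ.+ i) (length-filter P? as)

-- The weight of κ is the monomial with exponents κ, whose coefficient at α is the indicator that κ
-- is counted by `X` at α.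
X≈chromatic : ∀ {n} m (H : Graph n) → let open Truncated m; open ChromaticSum (truncatedRing m) var in
              X H ≈ chromatic H
X≈chromatic {n} m H α = begin
  X H (toList α)
    ≡⟨ ≡.cong (λ k → + length (filter (λ κ → proper? H κ ×-dec List.≡-dec ℕ._≟_ (exponents κ) (toList α)) (colourings n k)))
         (Vec.length-toList α) ⟩
  + length (filter (λ κ → proper? H κ ×-dec List.≡-dec ℕ._≟_ (exponents κ) (toList α)) (colourings n m))
    ≡⟨ length-filter _ (colourings n m) ⟩
  ℤ∑.∑ (colourings n m) (λ κ → indℤ (proper? H κ ×-dec List.≡-dec ℕ._≟_ (exponents κ) (toList α)))
    ≡⟨ ℤ∑.∑-cong (colourings n m) (λ κ → term κ (does (proper? H κ))) ⟩
  ℤ∑.∑ (colourings n m) (λ κ → (ind (proper? H κ) * weight κ) (toList α))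
    ≡⟨ sumˣ-coefficient (colourings n m) (λ κ → ind (proper? H κ) * weight κ) (toList α) ⟨
  chromatic H (toList α) ∎
  where
  open Truncated m
  open ChromaticSum (truncatedRing m) var
  open ≡.≡-Reasoning
  term : ∀ κ t → (if t ∧ does (List.≡-dec ℕ._≟_ (exponents κ) (toList α)) then 1ℤ else 0ℤ) ≡
                 ((if t then 1ˣ else 0ˣ) * weight κ) (toList α)
  term κ true  = ≡.trans (monomial-coefficient _ α) (≡.sym (≡.trans (*-identityˡ (weight κ) α) (weight≈monomial κ α)))
  term κ false = ≡.sym (zeroˡ (weight κ) α)

-- Lifted series do not contain the first variable, so neither does their product: only exponent 0
-- of that variable survives.
elementary-lift : ∀ m Fs i a (α : Vec ℕ m) →
  Truncated.elementary (suc m) (map lift Fs) i (a ∷ toList α) ≡ constant (Truncated.elementary m Fs i) a (toList α)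
elementary-lift m []       zero    zero    α = ≡.refl
elementary-lift m []       zero    (suc a) α = ≡.refl
elementary-lift m []       (suc i) zero    α = ≡.refl
elementary-lift m []       (suc i) (suc a) α = ≡.refl
elementary-lift m (F ∷ Fs) zero    a       α = ≡.trans
  (Truncated.elementary-zero (suc m) (lift F) (map lift Fs) (a ∷ α))
  (≡.trans (elementary-lift m Fs 0 a α) (right-case a))
  where
  right-case : ∀ a → constant (Truncated.elementary m Fs 0) a (toList α) ≡
                     constant (Truncated.elementary m (F ∷ Fs) 0) a (toList α)
  right-case zero    = ≡.sym (Truncated.elementary-zero m F Fs α)
  right-case (suc a) = ≡.refl
elementary-lift m (F ∷ Fs) (suc i) a       α = begin
  Eₘ₊₁ (lift F ∷ map lift Fs) (suc i) (a ∷ toList α)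
    ≡⟨ Truncated.elementary-suc (suc m) (lift F) (map lift Fs) i (a ∷ α) ⟩
  Eₘ₊₁ (map lift Fs) (suc i) (a ∷ toList α) ℤ.+ (lift F *ˣ Eₘ₊₁ (map lift Fs) i) (a ∷ toList α)
    ≡⟨ ≡.cong₂ ℤ._+_ (elementary-lift m Fs (suc i) a α) (curry-* (lift F) (Eₘ₊₁ (map lift Fs) i) a (toList α)) ⟩
  constant (elementary Fs (suc i)) a (toList α) ℤ.+ (constant F ⊛ curry (Eₘ₊₁ (map lift Fs) i)) a (toList α)
    ≡⟨ ≡.cong (λ j → constant (elementary Fs (suc i)) a (toList α) ℤ.+ j) (constant-⊛ m F (curry (Eₘ₊₁ (map lift Fs) i)) a α) ⟩
  constant (elementary Fs (suc i)) a (toList α) ℤ.+ (F *ˣ curry (Eₘ₊₁ (map lift Fs) i) a) (toList α)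
    ≡⟨ ≡.cong (λ j → constant (elementary Fs (suc i)) a (toList α) ℤ.+ j)
         (*-congˡ {F} {curry (Eₘ₊₁ (map lift Fs) i) a} {constant (elementary Fs i) a} (elementary-lift m Fs i a) α) ⟩
  constant (elementary Fs (suc i)) a (toList α) ℤ.+ (F *ˣ constant (elementary Fs i) a) (toList α)
    ≡⟨ right-case a ⟩
  constant (elementary (F ∷ Fs) (suc i)) a (toList α) ∎
  where
  open Truncated m
  open ≡.≡-Reasoning
  Eₘ₊₁ = Truncated.elementary (suc m)
  right-case : ∀ a → constant (elementary Fs (suc i)) a (toList α) ℤ.+ (F *ˣ constant (elementary Fs i) a) (toList α) ≡
                     constant (elementary (F ∷ Fs) (suc i)) a (toList α)
  right-case zero    = ≡.sym (elementary-suc F Fs i α)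
  right-case (suc a) = ≡.trans (ℤ.+-identityˡ _) (zeroʳ F α)

vars-suc : ∀ m → map var (allFin (suc m)) ≡ var {suc m} zero ∷ map lift (map var (allFin m))
vars-suc m = ≡.cong (var {suc m} zero ∷_) (begin
  map var (tabulate suc)             ≡⟨ List.map-tabulate suc var ⟩
  tabulate (lift ∘ var)              ≡⟨ List.map-tabulate id (lift ∘ var) ⟨
  map (lift ∘ var) (allFin m)        ≡⟨ List.map-∘ (allFin m) ⟩
  map lift (map var (allFin m))      ∎)
  where open ≡.≡-Reasoning

-- The factor 1 + x z of the first variable x contributes `e (suc i)`, `e i` or nothing in the other
-- variables, according as its exponent a is 0, 1 or larger.
e≈elementary : ∀ m i → let open Truncated m in e i ≈ elementary (map var (allFin m)) i
e≈elementary zero    zero    []      = ≡.refl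
e≈elementary zero    (suc i) []      = ≡.refl
e≈elementary (suc m) zero    (a ∷ α) = begin
  e 0 (a ∷ toList α)
    ≡⟨ left-case a ⟩
  constant (e 0) a (toList α)
    ≡⟨ constant-cong a ⟩
  constant (Truncated.elementary m vars 0) a (toList α)
    ≡⟨ elementary-lift m vars 0 a α ⟨
  Truncated.elementary (suc m) (map lift vars) 0 (a ∷ toList α)
    ≡⟨ Truncated.elementary-zero (suc m) (var {suc m} zero) (map lift vars) (a ∷ α) ⟨
  Truncated.elementary (suc m) (var {suc m} zero ∷ map lift vars) 0 (a ∷ toList α)
    ≡⟨ ≡.cong (λ Fs → Truncated.elementary (suc m) Fs 0 (a ∷ toList α)) (vars-suc m) ⟨
  Truncated.elementary (suc m) (map var (allFin (suc m))) 0 (a ∷ toList α) ∎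
  where
  open ≡.≡-Reasoning
  vars = map var (allFin m)
  left-case : ∀ a → e 0 (a ∷ toList α) ≡ constant (e 0) a (toList α)
  left-case zero          = ≡.refl
  left-case (suc zero)    = ≡.cong (λ t → if t then 1ℤ else 0ℤ) (Bool.∧-zeroʳ (does (All.all? (ℕ._≤? 1) (toList α))))
  left-case (suc (suc a)) = ≡.refl
  constant-cong : ∀ a → constant (e 0) a (toList α) ≡ constant (Truncated.elementary m vars 0) a (toList α)
  constant-cong zero    = e≈elementary m 0 α
  constant-cong (suc a) = ≡.refl
e≈elementary (suc m) (suc i) (a ∷ α) = begin
  e (suc i) (a ∷ toList α)
    ≡⟨ left-case a ⟩
  constant (E (suc i)) a (toList α) ℤ.+ (linear 1ˣ ⊛ curry (Eₘ₊₁ i)) a (toList α)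
    ≡⟨ ≡.cong₂ ℤ._+_ (elementary-lift m vars (suc i) a α) (curry-* (var {suc m} zero) (Eₘ₊₁ i) a (toList α)) ⟨
  Eₘ₊₁ (suc i) (a ∷ toList α) ℤ.+ (var {suc m} zero *ˣ Eₘ₊₁ i) (a ∷ toList α)
    ≡⟨ Truncated.elementary-suc (suc m) (var {suc m} zero) (map lift vars) i (a ∷ α) ⟨
  Truncated.elementary (suc m) (var {suc m} zero ∷ map lift vars) (suc i) (a ∷ toList α)
    ≡⟨ ≡.cong (λ Fs → Truncated.elementary (suc m) Fs (suc i) (a ∷ toList α)) (vars-suc m) ⟨
  Truncated.elementary (suc m) (map var (allFin (suc m))) (suc i) (a ∷ toList α) ∎
  where
  open Truncated m
  open ≡.≡-Reasoning
  vars = map var (allFin m)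
  E = elementary vars
  Eₘ₊₁ = Truncated.elementary (suc m) (map lift vars)
  product-suc : ∀ a → (linear 1ˣ ⊛ curry (Eₘ₊₁ i)) (suc a) (toList α) ≡ constant (E i) a (toList α)
  product-suc a = ≡.trans (linear-⊛-tail 1ˣ (curry (Eₘ₊₁ i)) a α)
    (≡.trans (*-identityˡ (curry (Eₘ₊₁ i) a) α) (elementary-lift m vars i a α))
  left-case : ∀ a → e (suc i) (a ∷ toList α) ≡ constant (E (suc i)) a (toList α) ℤ.+ (linear 1ˣ ⊛ curry (Eₘ₊₁ i)) a (toList α)
  left-case zero          = ≡.trans (e≈elementary m (suc i) α)
    (≡.sym (≡.trans (≡.cong (λ j → E (suc i) (toList α) ℤ.+ j) (linear-⊛-head 1ˣ (curry (Eₘ₊₁ i)) α)) (ℤ.+-identityʳ _)))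
  left-case (suc zero)    = ≡.trans (e≈elementary m i α) (≡.sym (≡.trans (ℤ.+-identityˡ _) (product-suc 0)))
  left-case (suc (suc a)) = ≡.sym (≡.trans (ℤ.+-identityˡ _) (product-suc (suc a)))

-- Monomials in z, and the induction on ℓ.

module Monomials {c ℓ} (R : CommutativeRing c ℓ) where

  open CommutativeRing R hiding (zero)
  open PowerSeries R
  open ListSum R
  private module S = CommutativeRing seriesRing
  open ListSum seriesRing using () renaming (∑ to ∑ₛ)

  infix 9 _z^_
  _z^_ : Carrier → ℕ → Series
  (a z^ k) n = if does (n ℕ.≟ k) then a else 0#

  z^-cong : ∀ {a b} k → a ≈ b → a z^ k ≋ b z^ k
  z^-cong k a≈b n with does (n ℕ.≟ k)
  ... | true  = a≈b
  ... | false = refl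

  z^-+ : ∀ a b k → (a + b) z^ k ≋ a z^ k S.+ b z^ k
  z^-+ a b k n with does (n ℕ.≟ k)
  ... | true  = refl
  ... | false = sym (+-identityˡ 0#)

  z^-zero : ∀ k → 0# z^ k ≋ S.0#
  z^-zero k n with does (n ℕ.≟ k)
  ... | true  = refl
  ... | false = refl

  ∑-z^ : ∀ {a} {A : Set a} (as : List A) (g : A → Carrier) k → ∑ₛ as (λ a → g a z^ k) ≋ ∑ as g z^ k
  ∑-z^ []       g k = S.sym (z^-zero k)
  ∑-z^ (a ∷ as) g k = S.trans (S.+-congˡ (∑-z^ as g k)) (S.sym (z^-+ (g a) (∑ as g) k))

  1z^0≋1 : 1# z^ 0 ≋ one
  1z^0≋1 zero    = refl
  1z^0≋1 (suc n) = refl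

  z^0-⊛ : ∀ a F n → (a z^ 0 ⊛ F) n ≈ a * F n
  z^0-⊛ a F zero    = ⊛-head (a z^ 0) F
  z^0-⊛ a F (suc n) = trans (⊛-tail (a z^ 0) F n) (trans (+-congˡ (⊛-zeroˡ F n)) (+-identityʳ _))

  z^suc-⊛-suc : ∀ a k F n → (a z^ suc k ⊛ F) (suc n) ≈ (a z^ k ⊛ F) n
  z^suc-⊛-suc a k F n = trans (⊛-tail (a z^ suc k) F n) (trans (+-congʳ (zeroˡ _)) (+-identityˡ _))

  z^-⊛ : ∀ a k F n → (a z^ k ⊛ F) (k ℕ.+ n) ≈ a * F n
  z^-⊛ a zero    F n = z^0-⊛ a F n
  z^-⊛ a (suc k) F n = trans (z^suc-⊛-suc a k F (k ℕ.+ n)) (z^-⊛ a k F n)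

  z^-⊛-at : ∀ a k F n {N} → k ℕ.+ n ≡ N → (a z^ k ⊛ F) N ≈ a * F n
  z^-⊛-at a k F n ≡.refl = z^-⊛ a k F n

  z^-⊛-z^ : ∀ a b i j → a z^ i ⊛ b z^ j ≋ (a * b) z^ (i ℕ.+ j)
  z^-⊛-z^ a b zero    j n = trans (z^0-⊛ a (b z^ j) n) coefficient
    where
    coefficient : a * (b z^ j) n ≈ ((a * b) z^ j) n
    coefficient with does (n ℕ.≟ j)
    ... | true  = refl
    ... | false = zeroʳ a
  z^-⊛-z^ a b (suc i) j zero    = trans (⊛-head (a z^ suc i) (b z^ j)) (zeroˡ _)
  z^-⊛-z^ a b (suc i) j (suc n) = trans (z^suc-⊛-suc a i (b z^ j) n) (z^-⊛-z^ a b i j n)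

-- P, e, g and h stand for X_{P_i}, e_i, (i − 1) e_i and (i − 2) e_i.
module Expansion {c ℓ} (R : CommutativeRing c ℓ) (P e g h : ℕ → CommutativeRing.Carrier R)
  (2# 1#′ : CommutativeRing.Carrier R)
  (2#≈1+1 : CommutativeRing._≈_ R 2# (CommutativeRing._+_ R (CommutativeRing.1# R) (CommutativeRing.1# R)))
  (1#′≈1 : CommutativeRing._≈_ R 1#′ (CommutativeRing.1# R)) where

  open CommutativeRing R hiding (zero)
  open PowerSeries R
  open ListSum R
  open Monomials R
  open TwinFormula R
  private module S = CommutativeRing seriesRing
  open ListSum seriesRing using ()
    renaming (∑ to ∑ₛ; ∑-+ to ∑ₛ-+; *-∑ to *-∑ₛ; ∑-upTo-cong to ∑ₛ-upTo-cong; ∑-upTo-last to ∑ₛ-upTo-last)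
  open Solver seriesRing
  open Relation.Binary.Reasoning.Setoid S.setoid

  G : ℕ → Series
  G k i = if does (k ℕ.≤? i) then g i else 0#

  -- Carlitz's formula says that B 2 is P; the higher thresholds in the theorem are reached from it
  -- by `B-suc`.
  B : ℕ → Series
  B k = e S.+ P ⊛ G k

  two : Series
  two = 2# z^ 0

  two≋ : S.1# S.+ S.1# ≋ two
  two≋ = S.sym (S.trans (S.trans (z^-cong 0 2#≈1+1) (z^-+ 1# 1# 0)) (S.+-cong 1z^0≋1 1z^0≋1))

  -- Here k is ℓ - 2.
  f : ℕ → Series
  f k = two S.+ e 1 z^ 1 S.- P (suc k) z^ suc k ⊛ (1#′ z^ 0 S.- e 2 z^ 2)
          S.- P (2 ℕ.+ k) z^ (2 ℕ.+ k) S.- P (3 ℕ.+ k) z^ (3 ℕ.+ k)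

  -- The theorem has n = ℓ - 2 and s = ℓ + 1. They are separate because the induction first raises
  -- all thresholds and then adds a summand.
  tailSum : ℕ → ℕ → Series
  tailSum n s = ∑ₛ (upTo n) λ i → B (s ∸ i) ⊛ P (suc i) z^ suc i

  expansion : ℕ → Series
  expansion k = P ⊛ ∑ₛ (upTo (suc k)) (λ i → h (3 ℕ.+ i) z^ (3 ℕ.+ i)) S.+ two ⊛ B (4 ℕ.+ k) S.+ tailSum k (3 ℕ.+ k)

  f≋ : ∀ k → f k ≋ S.1# S.+ S.1# S.+ e 1 z^ 1 S.- P (suc k) z^ suc k S.+ (P (suc k) * e 2) z^ (3 ℕ.+ k)
                   S.- P (2 ℕ.+ k) z^ (2 ℕ.+ k) S.- P (3 ℕ.+ k) z^ (3 ℕ.+ k)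
  f≋ k = begin
    f k
      ≈⟨ S.+-congʳ (S.+-congʳ (S.+-cong (S.+-congʳ (S.sym two≋))
           (S.-‿cong (S.*-congˡ (S.+-congʳ (S.trans (z^-cong 0 1#′≈1) 1z^0≋1)))))) ⟩
    S.1# S.+ S.1# S.+ e 1 z^ 1 S.- a ⊛ (S.1# S.- e 2 z^ 2) S.- b S.- c′
      ≈⟨ solve 5 (λ E a E₂ b c → con (+ 1) :+ con (+ 1) :+ E :- a :* (con (+ 1) :- E₂) :- b :- c
           := con (+ 1) :+ con (+ 1) :+ E :- a :+ a :* E₂ :- b :- c) S.refl (e 1 z^ 1) a (e 2 z^ 2) b c′ ⟩
    S.1# S.+ S.1# S.+ e 1 z^ 1 S.- a S.+ a ⊛ e 2 z^ 2 S.- b S.- c′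
      ≈⟨ S.+-congʳ (S.+-congʳ (S.+-congˡ (S.trans (z^-⊛-z^ (P (suc k)) (e 2) (suc k) 2)
           (S.reflexive (≡.cong ((P (suc k) * e 2) z^_) (ℕ.+-comm (suc k) 2)))))) ⟩
    _ ∎
    where
    a = P (suc k) z^ suc k
    b = P (2 ℕ.+ k) z^ (2 ℕ.+ k)
    c′ = P (3 ℕ.+ k) z^ (3 ℕ.+ k)

  G-≤ : ∀ {k i} → k ≤ i → G k i ≡ g i
  G-≤ {k} {i} k≤i = ≡.cong (if_then g i else 0#) (dec-true (k ℕ.≤? i) k≤i)

  G-≰ : ∀ {k i} → ¬ k ≤ i → G k i ≡ 0#
  G-≰ {k} {i} k≰i = ≡.cong (if_then g i else 0#) (dec-false (k ℕ.≤? i) k≰i)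

  G-suc : ∀ k → G k ≋ g k z^ k S.+ G (suc k)
  G-suc k i with ℕ.<-cmp i k
  ... | tri< i<k i≢k _   = trans (reflexive (G-≰ (ℕ.<⇒≱ i<k))) (sym (trans
    (+-cong (reflexive (≡.cong (if_then g k else 0#) (dec-false (i ℕ.≟ k) i≢k))) (reflexive (G-≰ (ℕ.<⇒≱ (ℕ.m<n⇒m<1+n i<k)))))
    (+-identityˡ _)))
  ... | tri≈ _ ≡.refl _  = trans (reflexive (G-≤ ℕ.≤-refl)) (sym (trans
    (+-cong (reflexive (≡.cong (if_then g k else 0#) (dec-true (i ℕ.≟ k) ≡.refl))) (reflexive (G-≰ (ℕ.<-irrefl ≡.refl))))
    (+-identityʳ _)))
  ... | tri> _ i≢k k<i   = trans (reflexive (G-≤ (ℕ.<⇒≤ k<i))) (sym (trans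
    (+-cong (reflexive (≡.cong (if_then g k else 0#) (dec-false (i ℕ.≟ k) i≢k))) (reflexive (G-≤ k<i)))
    (+-identityˡ _)))

  B-suc : ∀ k → B k ≋ P ⊛ g k z^ k S.+ B (suc k)
  B-suc k = S.trans (S.+-congˡ (S.*-congˡ (G-suc k)))
    (solve 4 (λ E P a b → E :+ P :* (a :+ b) := P :* a :+ (E :+ P :* b)) S.refl e P (g k z^ k) (G (suc k)))

  -- The summand that enters in the induction has threshold 4 for every ℓ, and B 4 is explicitly
  -- known by `B₄`.
  tailSum-last : ∀ k → tailSum (suc k) (4 ℕ.+ k) ≋ tailSum k (4 ℕ.+ k) S.+ B 4 ⊛ P (suc k) z^ suc k
  tailSum-last k = S.trans (∑ₛ-upTo-last k (λ i → B ((4 ℕ.+ k) ∸ i) ⊛ P (suc i) z^ suc i))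
    (S.+-congˡ {tailSum k (4 ℕ.+ k)} (S.reflexive (≡.cong (λ j → B j ⊛ P (suc k) z^ suc k) (ℕ.m+n∸n≡m 4 k))))

  middle : ℕ → Carrier
  middle k = ∑ (upTo k) λ i → P (suc i) * g ((3 ℕ.+ k) ∸ i)

  -- Raising the threshold j = 3 + k - i by one loses P g_j z^j; times P_{i+1} z^{i+1} this has
  -- degree 4 + k in the monomial part for every i, so the losses add up to `middle k`.
  tailSum-step : ∀ k → tailSum k (3 ℕ.+ k) ≋ tailSum k (4 ℕ.+ k) S.+ P ⊛ middle k z^ (4 ℕ.+ k)
  tailSum-step k = begin
    tailSum k (3 ℕ.+ k)
      ≈⟨ ∑ₛ-upTo-cong k term ⟩
    ∑ₛ (upTo k) (λ i → B ((4 ℕ.+ k) ∸ i) ⊛ P (suc i) z^ suc i S.+ P ⊛ (P (suc i) * g ((3 ℕ.+ k) ∸ i)) z^ (4 ℕ.+ k))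
      ≈⟨ ∑ₛ-+ (upTo k) _ _ ⟩
    tailSum k (4 ℕ.+ k) S.+ ∑ₛ (upTo k) (λ i → P ⊛ (P (suc i) * g ((3 ℕ.+ k) ∸ i)) z^ (4 ℕ.+ k))
      ≈⟨ S.+-congˡ {tailSum k (4 ℕ.+ k)} (S.trans (*-∑ₛ P (upTo k) _) (S.*-congˡ {P} (∑-z^ (upTo k) _ (4 ℕ.+ k)))) ⟩
    tailSum k (4 ℕ.+ k) S.+ P ⊛ middle k z^ (4 ℕ.+ k) ∎
    where
    term : ∀ i → i < k → B ((3 ℕ.+ k) ∸ i) ⊛ P (suc i) z^ suc i ≋
           B ((4 ℕ.+ k) ∸ i) ⊛ P (suc i) z^ suc i S.+ P ⊛ (P (suc i) * g ((3 ℕ.+ k) ∸ i)) z^ (4 ℕ.+ k)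
    term i i<k = begin
      B j ⊛ p
        ≈⟨ S.*-congʳ {p} (B-suc j) ⟩
      (P ⊛ g j z^ j S.+ B (suc j)) ⊛ p
        ≈⟨ solve 4 (λ P g B p → (P :* g :+ B) :* p := B :* p :+ P :* (p :* g)) S.refl P (g j z^ j) (B (suc j)) p ⟩
      B (suc j) ⊛ p S.+ P ⊛ (p ⊛ g j z^ j)
        ≈⟨ S.+-cong (S.reflexive (≡.cong (λ l → B l ⊛ p) (≡.sym (ℕ.+-∸-assoc 1 i≤3+k))))
             (S.*-congˡ {P} (S.trans (z^-⊛-z^ (P (suc i)) (g j) (suc i) j)
               (S.reflexive (≡.cong ((P (suc i) * g j) z^_) (≡.cong suc (ℕ.m+[n∸m]≡n i≤3+k)))))) ⟩
      B ((4 ℕ.+ k) ∸ i) ⊛ p S.+ P ⊛ (P (suc i) * g j) z^ (4 ℕ.+ k) ∎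
      where
      j = (3 ℕ.+ k) ∸ i
      p = P (suc i) z^ suc i
      i≤3+k : i ≤ 3 ℕ.+ k
      i≤3+k = ℕ.≤-trans (ℕ.<⇒≤ i<k) (ℕ.m≤n+m k 3)

  module _ (recursion : P ≋ B 2) (P₀ : P 0 ≈ 1#) (g₂ : g 2 ≈ e 2) (h+e : ∀ i → h (3 ℕ.+ i) + e (3 ℕ.+ i) ≈ g (3 ℕ.+ i)) where

    private module R = Solver R

    B₄ : B 4 ≋ P S.- P ⊛ g 2 z^ 2 S.- P ⊛ g 3 z^ 3
    B₄ = begin
      B 4 ≈⟨ solve 3 (λ a b c → c := (a :+ (b :+ c)) :- a :- b) S.refl (P ⊛ g 2 z^ 2) (P ⊛ g 3 z^ 3) (B 4) ⟩
      (P ⊛ g 2 z^ 2 S.+ (P ⊛ g 3 z^ 3 S.+ B 4)) S.- P ⊛ g 2 z^ 2 S.- P ⊛ g 3 z^ 3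
        ≈⟨ S.+-congʳ (S.+-congʳ (S.sym (S.trans recursion (S.trans (B-suc 2) (S.+-congˡ (B-suc 3)))))) ⟩
      P S.- P ⊛ g 2 z^ 2 S.- P ⊛ g 3 z^ 3 ∎

    P₁ : P 1 ≈ e 1
    P₁ = trans (recursion 1) (R.solve 3 (λ a p q → a R.:+ (p R.:* R.con (+ 0) R.:+ (q R.:* R.con (+ 0) R.:+ R.con (+ 0))) R.:= a) refl _ _ _)

    P₂ : P 2 ≈ e 2 + g 2
    P₂ = trans (recursion 2) (trans (+-congˡ (+-congʳ (*-congʳ P₀))) (R.solve 4 (λ a b p q →
      a R.:+ (R.con (+ 1) R.:* b R.:+ (p R.:* R.con (+ 0) R.:+ (q R.:* R.con (+ 0) R.:+ R.con (+ 0)))) R.:= a R.:+ b) refl _ _ _ _))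

    P₃ : P 3 ≈ e 3 + g 3 + P 1 * g 2
    P₃ = trans (recursion 3) (trans (+-congˡ (+-congʳ (*-congʳ P₀))) (R.solve 6 (λ a b d r p q →
      a R.:+ (R.con (+ 1) R.:* b R.:+ (r R.:* d R.:+ (p R.:* R.con (+ 0) R.:+ (q R.:* R.con (+ 0) R.:+ R.con (+ 0))))) R.:= a R.:+ b R.:+ r R.:* d) refl _ _ _ _ _ _))

    -- The recursion in degree 4 + k. The terms with G 2 1 and G 2 0 vanish; those with g 3 and g 2
    -- are kept out of `middle`, as they belong to B 4 and to the e 2 term of f.
    P₄₊ : ∀ k → P (4 ℕ.+ k) ≈ e (4 ℕ.+ k) + (g (4 ℕ.+ k) + (middle k + P (suc k) * g 3 + P (2 ℕ.+ k) * g 2))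
    P₄₊ k = trans (recursion (4 ℕ.+ k)) (+-congˡ (trans (⊛-tail P (G 2) (3 ℕ.+ k))
      (+-cong (trans (*-congʳ P₀) (*-identityˡ _))
      (trans (∑-upTo-last (3 ℕ.+ k) F) (trans (+-congʳ (trans (∑-upTo-last (2 ℕ.+ k) F) (+-congʳ (trans (∑-upTo-last (1 ℕ.+ k) F) (+-congʳ (∑-upTo-last k F))))))
      (trans (+-cong (+-cong (+-cong (+-cong
        (∑-upTo-cong k λ i i<k → *-congˡ (reflexive (G-≤ (ℕ.m+n≤o⇒m≤o∸n 2 (ℕ.≤-trans (ℕ.+-monoʳ-≤ 2 (ℕ.<⇒≤ i<k)) (ℕ.n≤1+n _))))))
        (F-at 3 k ≡.refl)) (F-at 2 (suc k) ≡.refl)) (F-at 1 (suc (suc k)) ≡.refl)) (F-at 0 (3 ℕ.+ k) ≡.refl))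
      (R.solve 5 (λ s a b p q → s R.:+ a R.:+ b R.:+ p R.:* R.con (+ 0) R.:+ q R.:* R.con (+ 0) R.:= s R.:+ a R.:+ b) refl _ _ _ _ _)))))))
      where
      F : ℕ → Carrier
      F i = P (suc i) * G 2 ((3 ℕ.+ k) ∸ i)
      F-at : ∀ d i → d ℕ.+ i ≡ 3 ℕ.+ k → F i ≈ P (suc i) * G 2 d
      F-at d i eq = *-congˡ (reflexive (≡.cong (G 2) (≡.trans (≡.cong (_∸ i) (≡.sym eq)) (ℕ.m+n∸n≡m d i))))

    identity-base : P ⊛ f 0 ≋ expansion 0
    identity-base = begin
      P ⊛ f 0
        ≈⟨ S.*-congˡ {P} (f≋ 0) ⟩
      P ⊛ (S.1# S.+ S.1# S.+ e 1 z^ 1 S.- P 1 z^ 1 S.+ (P 1 * e 2) z^ 3 S.- P 2 z^ 2 S.- P 3 z^ 3)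
        ≈⟨ S.*-congˡ {P} (S.+-cong (S.+-cong (S.+-cong (S.+-congˡ {S.1# S.+ S.1# S.+ e 1 z^ 1} (S.-‿cong (z^-cong 1 P₁)))
             (z^-cong 3 (*-congˡ (sym g₂))))
             (S.-‿cong (S.trans (z^-cong 2 (trans P₂ (+-congʳ (sym g₂)))) (z^-+ (g 2) (g 2) 2))))
             (S.-‿cong (S.trans (z^-cong 3 P₃) (S.trans (z^-+ (e 3 + g 3) (P 1 * g 2) 3)
               (S.+-congʳ {q} (S.trans (z^-+ (e 3) (g 3) 3) (S.+-congˡ {ε} g≋))))))) ⟩
      P ⊛ (S.1# S.+ S.1# S.+ e 1 z^ 1 S.- e 1 z^ 1 S.+ q S.- (γ S.+ γ) S.- (ε S.+ (η S.+ ε) S.+ q))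
        -- The e 1 terms cancel, as do the two q, one of which comes from P 3. There remains 2 (1 -
        -- γ - (η + ε)) + η, whose bracket times P is B 4.
        ≈⟨ solve 6 (λ P E q γ ε η → P :* (con (+ 1) :+ con (+ 1) :+ E :- E :+ q :- (γ :+ γ) :- (ε :+ (η :+ ε) :+ q))
             := P :* (η :+ con (+ 0)) :+ (con (+ 1) :+ con (+ 1)) :* (P :- P :* γ :- P :* (η :+ ε)) :+ con (+ 0)) S.refl P (e 1 z^ 1) q γ ε η ⟩
      P ⊛ (η S.+ S.0#) S.+ (S.1# S.+ S.1#) ⊛ (P S.- P ⊛ γ S.- P ⊛ (η S.+ ε)) S.+ S.0#
        ≈⟨ S.+-congʳ {S.0#} (S.+-congˡ {P ⊛ (η S.+ S.0#)} (S.*-cong two≋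
             (S.trans (S.+-congˡ {P S.- P ⊛ γ} (S.-‿cong (S.*-congˡ {P} (S.sym g≋)))) (S.sym B₄)))) ⟩
      expansion 0 ∎
      where
      q = (P 1 * g 2) z^ 3
      γ = g 2 z^ 2
      ε = e 3 z^ 3
      η = h 3 z^ 3
      g≋ : g 3 z^ 3 ≋ η S.+ ε
      g≋ = S.trans (z^-cong 3 (sym (h+e 0))) (z^-+ (h 3) (e 3) 3)

    -- From ℓ to ℓ + 1, f gains a - q + q′ - d. Expanded by `P₄₊`, this is a (1 - γ₂ - γ₃) - (η + 2
    -- ε) - M. The first part times P is the new summand B 4 ⊛ a; M cancels the loss in
    -- `tailSum-step`; raising the threshold of the doubled bracket frees 2 (η + ε), so one η is
    -- left for the first sum.
    identity : ∀ k → P ⊛ f k ≋ expansion k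
    identity zero    = identity-base
    identity (suc k) = begin
      P ⊛ f (suc k)
        ≈⟨ S.*-congˡ {P} (f≋ (suc k)) ⟩
      P ⊛ (S.1# S.+ S.1# S.+ E₁ S.- b S.+ q′ S.- c′ S.- d)
        ≈⟨ solve 8 (λ P E a b c d q q′ → P :* (con (+ 1) :+ con (+ 1) :+ E :- b :+ q′ :- c :- d) :=
             P :* (con (+ 1) :+ con (+ 1) :+ E :- a :+ q :- b :- c) :+ P :* (a :- q :+ q′ :- d)) S.refl P E₁ a b c′ d q q′ ⟩
      P ⊛ (S.1# S.+ S.1# S.+ E₁ S.- a S.+ q S.- b S.- c′) S.+ P ⊛ (a S.- q S.+ q′ S.- d)
        ≈⟨ S.+-cong
             (S.trans (S.*-congˡ {P} (S.sym (f≋ k))) (S.trans (identity k)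
               (S.+-cong (S.+-congˡ {P ⊛ H} (S.*-cong (S.sym two≋) (S.trans (B-suc (4 ℕ.+ k)) (S.+-congʳ {B (5 ℕ.+ k)} (S.*-congˡ {P} g≋)))))
                 (tailSum-step k))))
             (S.*-congˡ {P} (S.+-cong (S.+-congʳ {q′} (S.+-congˡ {a} (S.-‿cong q≋))) (S.-‿cong d≋))) ⟩
      (P ⊛ H S.+ (S.1# S.+ S.1#) ⊛ (P ⊛ (η S.+ ε) S.+ B (5 ℕ.+ k)) S.+ (tailSum k (4 ℕ.+ k) S.+ P ⊛ M))
        S.+ P ⊛ (a S.- γ₂ ⊛ a S.+ q′ S.- (ε S.+ ((η S.+ ε) S.+ (M S.+ γ₃ ⊛ a S.+ q′))))
        ≈⟨ solve 11 (λ P H η ε B T M a γ₂ q′ γ₃ →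
             (P :* H :+ (con (+ 1) :+ con (+ 1)) :* (P :* (η :+ ε) :+ B) :+ (T :+ P :* M))
               :+ P :* (a :- γ₂ :* a :+ q′ :- (ε :+ ((η :+ ε) :+ (M :+ γ₃ :* a :+ q′))))
             := P :* (H :+ η) :+ (con (+ 1) :+ con (+ 1)) :* B :+ (T :+ (P :- P :* γ₂ :- P :* γ₃) :* a))
             S.refl P H η ε (B (5 ℕ.+ k)) (tailSum k (4 ℕ.+ k)) M a γ₂ q′ γ₃ ⟩
      P ⊛ (H S.+ η) S.+ (S.1# S.+ S.1#) ⊛ B (5 ℕ.+ k) S.+ (tailSum k (4 ℕ.+ k) S.+ (P S.- P ⊛ γ₂ S.- P ⊛ γ₃) ⊛ a)
        ≈⟨ S.+-cong (S.+-cong (S.*-congˡ {P} (S.sym (∑ₛ-upTo-last (suc k) (λ i → h (3 ℕ.+ i) z^ (3 ℕ.+ i)))))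
             (S.*-congʳ {B (5 ℕ.+ k)} two≋))
             (S.trans (S.+-congˡ {tailSum k (4 ℕ.+ k)} (S.*-congʳ {a} (S.sym B₄))) (S.sym (tailSum-last k))) ⟩
      expansion (suc k) ∎
      where
      E₁ = e 1 z^ 1
      H = ∑ₛ (upTo (suc k)) (λ i → h (3 ℕ.+ i) z^ (3 ℕ.+ i))
      a = P (suc k) z^ suc k
      b = P (2 ℕ.+ k) z^ (2 ℕ.+ k)
      c′ = P (3 ℕ.+ k) z^ (3 ℕ.+ k)
      d = P (4 ℕ.+ k) z^ (4 ℕ.+ k)
      q = (P (suc k) * e 2) z^ (3 ℕ.+ k)
      q′ = (P (2 ℕ.+ k) * e 2) z^ (4 ℕ.+ k)
      γ₂ = g 2 z^ 2
      γ₃ = g 3 z^ 3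
      η = h (4 ℕ.+ k) z^ (4 ℕ.+ k)
      ε = e (4 ℕ.+ k) z^ (4 ℕ.+ k)
      M = middle k z^ (4 ℕ.+ k)
      g≋ : g (4 ℕ.+ k) z^ (4 ℕ.+ k) ≋ η S.+ ε
      g≋ = S.trans (z^-cong (4 ℕ.+ k) (sym (h+e (suc k)))) (z^-+ (h (4 ℕ.+ k)) (e (4 ℕ.+ k)) (4 ℕ.+ k))
      q≋ : q ≋ γ₂ ⊛ a
      q≋ = S.sym (S.trans (z^-⊛-z^ (g 2) (P (suc k)) 2 (suc k)) (z^-cong (3 ℕ.+ k) (trans (*-congʳ g₂) (*-comm _ _))))
      d≋ : d ≋ ε S.+ ((η S.+ ε) S.+ (M S.+ γ₃ ⊛ a S.+ q′))
      d≋ = begin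
        d
          ≈⟨ S.trans (z^-cong (4 ℕ.+ k) (P₄₊ k)) (z^-+ (e (4 ℕ.+ k)) _ (4 ℕ.+ k)) ⟩
        ε S.+ (g (4 ℕ.+ k) + (middle k + P (suc k) * g 3 + P (2 ℕ.+ k) * g 2)) z^ (4 ℕ.+ k)
          ≈⟨ S.+-congˡ {ε} (z^-+ (g (4 ℕ.+ k)) _ (4 ℕ.+ k)) ⟩
        ε S.+ (g (4 ℕ.+ k) z^ (4 ℕ.+ k) S.+ (middle k + P (suc k) * g 3 + P (2 ℕ.+ k) * g 2) z^ (4 ℕ.+ k))
          ≈⟨ S.+-congˡ {ε} (S.+-cong g≋ (S.trans (z^-+ (middle k + P (suc k) * g 3) (P (2 ℕ.+ k) * g 2) (4 ℕ.+ k))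
               (S.+-cong (S.trans (z^-+ (middle k) (P (suc k) * g 3) (4 ℕ.+ k)) (S.+-congˡ {M}
                 (S.trans (z^-cong (4 ℕ.+ k) (*-comm _ _)) (S.sym (z^-⊛-z^ (g 3) (P (suc k)) 3 (suc k))))))
                 (z^-cong (4 ℕ.+ k) (*-congˡ g₂))))) ⟩
        ε S.+ ((η S.+ ε) S.+ (M S.+ γ₃ ⊛ a S.+ q′)) ∎

    -- N is n + 1 for a path with n = ℓ + j vertices. No term of f has degree above ℓ + 1 = 3 + k,
    -- so each of them contributes.
    ⊛-f-coefficient : ∀ k j → let i = suc k; N = 3 ℕ.+ (k ℕ.+ j) in
      (P ⊛ f k) N ≈ P N + P N + P 1 * P (suc i ℕ.+ j) - P i * P (suc (suc j)) + P i * e 2 * P j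
        - P (suc i) * P (suc j) - P (suc (suc i)) * P j
    ⊛-f-coefficient k j = trans
      (S.trans (S.*-congˡ {P} (f≋ k)) (solve 6 (λ P E a q b c → P :* (con (+ 1) :+ con (+ 1) :+ E :- a :+ q :- b :- c) :=
        P :+ P :+ E :* P :- a :* P :+ q :* P :- b :* P :- c :* P) S.refl P (e 1 z^ 1) (P (suc k) z^ suc k)
        ((P (suc k) * e 2) z^ (3 ℕ.+ k)) (P (2 ℕ.+ k) z^ (2 ℕ.+ k)) (P (3 ℕ.+ k) z^ (3 ℕ.+ k))) (3 ℕ.+ (k ℕ.+ j)))
      (+-cong (+-cong (+-cong (+-cong
        (+-congˡ (trans (z^-⊛ (e 1) 1 P (2 ℕ.+ (k ℕ.+ j))) (*-congʳ (sym P₁))))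
        (-‿cong (z^-⊛-at (P (suc k)) (suc k) P (2 ℕ.+ j) (≡.cong suc (≡.trans (ℕ.+-suc k (suc j)) (≡.cong suc (ℕ.+-suc k j)))))))
        (z^-⊛ (P (suc k) * e 2) (3 ℕ.+ k) P j))
        (-‿cong (z^-⊛-at (P (2 ℕ.+ k)) (2 ℕ.+ k) P (suc j) (≡.cong (λ n → 2 ℕ.+ n) (ℕ.+-suc k j)))))
        (-‿cong (z^-⊛ (P (3 ℕ.+ k)) (3 ℕ.+ k) P j)))

    -- P 2 = 2 e 2 makes the last term of `twinFormula` a double as well.
    twin-coefficient : ∀ {y} k j → y ≈ twinFormula P (suc k) j → y ≈ (P ⊛ f k) (3 ℕ.+ (k ℕ.+ j)) + (P ⊛ f k) (3 ℕ.+ (k ℕ.+ j))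
    twin-coefficient k j y≈ = trans (trans y≈
      (+-congˡ (trans (*-congʳ (*-congˡ (trans P₂ (+-congˡ g₂))))
        (R.solve 3 (λ a e₂ b → a R.:* (e₂ R.:+ e₂) R.:* b R.:= a R.:* e₂ R.:* b R.:+ a R.:* e₂ R.:* b) refl _ _ _))))
      (trans
        (R.solve 6 (λ N x y z a b →
          let C = N R.:+ N R.:+ x R.:- y R.:- z R.:- b
              D = N R.:+ N R.:+ x R.:- z R.:+ a R.:- y R.:- b
          in C R.:+ C R.:+ (a R.:+ a) R.:= D R.:+ D) refl _ _ _ _ _ _)
        (sym (+-cong (⊛-f-coefficient k j) (⊛-f-coefficient k j))))

-- Closure properties of e-positivity, and passage to partitions.

module ElementaryProduct {c ℓ} (R : CommutativeRing c ℓ) (e : ℕ → CommutativeRing.Carrier R) where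

  open CommutativeRing R hiding (zero)
  open ListSum R
  open Solver R
  open Relation.Binary.Reasoning.Setoid setoid

  prod : List ℕ → Carrier
  prod p = foldr _*_ 1# (map e p)

  prod-++ : ∀ p q → prod (p ++ q) ≈ prod p * prod q
  prod-++ []      q = sym (*-identityˡ _)
  prod-++ (i ∷ p) q = trans (*-congˡ (prod-++ p q)) (sym (*-assoc _ _ _))

  prod-↭ : ∀ {p q} → p ↭ q → prod p ≈ prod q
  prod-↭ ↭.refl         = refl
  prod-↭ (↭.prep i r)   = *-congˡ (prod-↭ r)
  prod-↭ (↭.swap i j r) = trans (*-congˡ (*-congˡ (prod-↭ r)))
    (solve 3 (λ a b y → a :* (b :* y) := b :* (a :* y)) refl _ _ _)
  prod-↭ (↭.trans r s)  = trans (prod-↭ r) (prod-↭ s)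

  prod-positive : e 0 ≈ 1# → ∀ p → prod (filter (1 ℕ.≤?_) p) ≈ prod p
  prod-positive e₀ []          = refl
  prod-positive e₀ (zero ∷ p)  = trans (prod-positive e₀ p) (sym (trans (*-congʳ e₀) (*-identityˡ _)))
  prod-positive e₀ (suc i ∷ p) = *-congˡ (prod-positive e₀ p)

  ∑-prod-* : ∀ ps qs → ∑ (concatMap (λ p → map (p ++_) qs) ps) prod ≈ ∑ ps prod * ∑ qs prod
  ∑-prod-* ps qs = begin
    ∑ (concatMap (λ p → map (p ++_) qs) ps) prod   ≈⟨ ∑-concatMap (λ p → map (p ++_) qs) ps prod ⟩
    ∑ ps (λ p → ∑ (map (p ++_) qs) prod)           ≈⟨ ∑-cong ps (λ p → reflexive (∑-map (p ++_) qs prod)) ⟩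
    ∑ ps (λ p → ∑ qs (λ q → prod (p ++ q)))        ≈⟨ ∑-cong ps (λ p → trans (∑-cong qs (prod-++ p)) (*-∑ _ qs prod)) ⟩
    ∑ ps (λ p → prod p * ∑ qs prod)                ≈⟨ ∑-* ps prod _ ⟩
    ∑ ps prod * ∑ qs prod                          ∎

module _ (m : ℕ) where
  open ElementaryProduct (truncatedRing m) e public using () renaming
    (prod-↭ to e[]-↭; prod-positive to e[]-positive; ∑-prod-* to ∑-e[]-*)

_≃_ : ℤ⟦x⟧ → ℤ⟦x⟧ → Set
F ≃ G = ∀ m → CommutativeRing._≈_ (truncatedRing m) F G

-- Unlike in EExpansion, the factors may be unsorted, may include e 0, and the
-- products may repeat; this makes closure under sums and products immediate.
record EGenerated (F : ℤ⟦x⟧) : Set where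
  constructor _,_
  field
    factors : List (List ℕ)
    expands : F ≃ sumˣ (map e[_] factors)

generated-resp : ∀ {F G} → F ≃ G → EGenerated G → EGenerated F
generated-resp F≃G (ps , eq) = ps , λ m α → ≡.trans (F≃G m α) (eq m α)

generated-0 : EGenerated 0ˣ
generated-0 = [] , λ m α → ≡.refl

generated-1 : EGenerated 1ˣ
generated-1 = ([] ∷ []) , λ m α → ≡.sym (ℤ.+-identityʳ _)

generated-e : ∀ i → EGenerated (e i)
generated-e i = ((i ∷ []) ∷ []) , λ m α →
  ≡.sym (≡.trans (ℤ.+-identityʳ _) (CommutativeRing.*-identityʳ (truncatedRing m) (e i) α))

generated-+ : ∀ {F G} → EGenerated F → EGenerated G → EGenerated (F +ˣ G)
generated-+ (ps , F≃) (qs , G≃) = ps ++ qs , λ m α →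
  ≡.trans (≡.cong₂ ℤ._+_ (F≃ m α) (G≃ m α)) (≡.sym (Truncated.∑-++ m ps qs e[_] α))

generated-* : ∀ {F G} → EGenerated F → EGenerated G → EGenerated (F *ˣ G)
generated-* {F} {G} (ps , F≃) (qs , G≃) = concatMap (λ p → map (p ++_) qs) ps , λ m α →
  ≡.trans (CommutativeRing.*-cong (truncatedRing m) {F} {sumˣ (map e[_] ps)} {G} {sumˣ (map e[_] qs)} (F≃ m) (G≃ m) α)
    (≡.sym (∑-e[]-* m ps qs α))

generated-· : ∀ n {F} → EGenerated F → EGenerated ((+ n) ·ˣ F)
generated-· zero    {F} F∈ = generated-resp (λ m α → ℤ.*-zeroˡ (F (toList α))) generated-0
generated-· (suc n) {F} F∈ = generated-resp (λ m α → ℤ.suc-* (+ n) (F (toList α))) (generated-+ F∈ (generated-· n F∈))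

generated-sum : ∀ {a} {A : Set a} {g : A → ℤ⟦x⟧} {as} → All (EGenerated ∘ g) as → EGenerated (sumˣ (map g as))
generated-sum []         = generated-0
generated-sum (g∈ ∷ gs∈) = generated-+ g∈ (generated-sum gs∈)

private
  module Sort≥ = Data.List.Sort (Flip.decTotalOrder ℕ.≤-decTotalOrder)

e₀≡1 : ∀ α → e 0 α ≡ 1ˣ α
e₀≡1 []                = ≡.refl
e₀≡1 (zero ∷ α)        = e₀≡1 α
e₀≡1 (suc zero ∷ α)    = ≡.cong (λ t → if t then 1ℤ else 0ℤ) (Bool.∧-zeroʳ (does (All.all? (ℕ._≤? 1) α)))
e₀≡1 (suc (suc a) ∷ α) = ≡.refl

toPartition : List ℕ → List ℕ
toPartition p = Sort≥.sort (filter (1 ℕ.≤?_) p)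

toPartition-isPartition : ∀ p → IsPartition (toPartition p)
toPartition-isPartition p = ↭.All-resp-↭ (↭-sym (Sort≥.sort-↭ _)) (All.all-filter (1 ℕ.≤?_) p) , Sort≥.sort-↗ _

e[toPartition] : ∀ p → e[ toPartition p ] ≃ e[ p ]
e[toPartition] p m α = ≡.trans (e[]-↭ m (Sort≥.sort-↭ (filter (1 ℕ.≤?_) p)) α) (e[]-positive m (λ α → e₀≡1 (toList α)) p α)

module _ {a} {A : Set a} (_≟_ : ∀ (x y : A) → Dec (x ≡ y)) where

  ∑-indicator-∉ : ∀ (E : A → ℤ) {p s} → All (p ≢_) s → ℤ∑.∑ s (λ q → indℤ (q ≟ p) ℤ.* E q) ≡ 0ℤ
  ∑-indicator-∉ E []                = ≡.refl
  ∑-indicator-∉ E {p} (_∷_ {x = q} p≢q p∉s) rewrite dec-false (q ≟ p) (p≢q ∘ ≡.sym) =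
    ≡.trans (≡.cong₂ ℤ._+_ (ℤ.*-zeroˡ (E q)) (∑-indicator-∉ E p∉s)) (ℤ.+-identityˡ 0ℤ)

  ∑-indicator-∈ : ∀ (E : A → ℤ) {p s} → Unique s → p ∈ s → ℤ∑.∑ s (λ q → indℤ (q ≟ p) ℤ.* E q) ≡ E p
  ∑-indicator-∈ E {p} (p∉s ∷ _) (here ≡.refl) rewrite dec-true (p ≟ p) ≡.refl =
    ≡.trans (≡.cong₂ ℤ._+_ (ℤ.*-identityˡ (E p)) (∑-indicator-∉ E p∉s)) (ℤ.+-identityʳ (E p))
  ∑-indicator-∈ E {p} (_∷_ {x = q} q∉s s!) (there p∈s) rewrite dec-false (q ≟ p) (All.lookup q∉s p∈s) =
    ≡.trans (≡.cong₂ ℤ._+_ (ℤ.*-zeroˡ (E q)) (∑-indicator-∈ E s! p∈s)) (ℤ.+-identityˡ (E p))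

  multiplicity : List A → A → ℤ
  multiplicity ps q = ℤ∑.∑ ps (λ p → indℤ (q ≟ p))

  multiplicity≥0 : ∀ ps q → 0ℤ ℤ.≤ multiplicity ps q
  multiplicity≥0 []       q = ℤ.≤-refl
  multiplicity≥0 (p ∷ ps) q = ℤ.+-mono-≤ (indℤ≥0 (does (q ≟ p))) (multiplicity≥0 ps q)
    where
    indℤ≥0 : ∀ t → 0ℤ ℤ.≤ (if t then 1ℤ else 0ℤ)
    indℤ≥0 true  = ℤ.+≤+ z≤n
    indℤ≥0 false = ℤ.≤-refl

  -- After exchanging the sums, each entry of ps meets an indicator sum over the deduplicated list,
  -- where it occurs exactly once.
  ∑-multiplicity : ∀ (E : A → ℤ) ps → ℤ∑.∑ (deduplicate _≟_ ps) (λ q → multiplicity ps q ℤ.* E q) ≡ ℤ∑.∑ ps E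
  ∑-multiplicity E ps = begin
    ℤ∑.∑ s (λ q → multiplicity ps q ℤ.* E q)                  ≡⟨ ℤ∑.∑-cong s (λ q → ≡.sym (ℤ∑.∑-* ps _ (E q))) ⟩
    ℤ∑.∑ s (λ q → ℤ∑.∑ ps λ p → indℤ (q ≟ p) ℤ.* E q)         ≡⟨ ℤ∑.∑-swap s ps _ ⟩
    ℤ∑.∑ ps (λ p → ℤ∑.∑ s λ q → indℤ (q ≟ p) ℤ.* E q)         ≡⟨ collapse ps (λ p∈ps → p∈ps) ⟩
    ℤ∑.∑ ps E                                                  ∎
    where
    open ≡.≡-Reasoning
    s = deduplicate _≟_ ps
    -- s must remain the deduplication of all of ps during the recursion, so the outer list is
    -- generalised to any qs contained in ps.
    collapse : ∀ qs → (∀ {p} → p ∈ qs → p ∈ ps) →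
               ℤ∑.∑ qs (λ p → ℤ∑.∑ s λ q → indℤ (q ≟ p) ℤ.* E q) ≡ ℤ∑.∑ qs E
    collapse []       _   = ≡.refl
    collapse (p ∷ qs) sub = ≡.cong₂ ℤ._+_
      (∑-indicator-∈ E (deduplicate-! _≟_ ps) (∈-deduplicate⁺ _≟_ (sub (here ≡.refl)))) (collapse qs (sub ∘ there))

-- Each α is tested in the ring with exactly length α variables.
≃⇒≡ : ∀ {F G} → F ≃ G → ∀ α → F α ≡ G α
≃⇒≡ {F} {G} F≃G α = ≡.subst (λ β → F β ≡ G β) (Vec.toList∘fromList α) (F≃G (length α) (fromList α))

-- Sorting the factors and dropping each e 0 = 1 gives partitions; the coefficient of a partition is
-- the number of products that yield it, hence nonnegative.
generated⇒EPositive : ∀ {F} → EGenerated F → EPositiveˣ F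
generated⇒EPositive {F} (ps , F≃) = record
  { support     = deduplicate _≟_ qs
  ; partitions  = All.tabulate λ q∈ → All.lookup (All.map⁺ (All.universal toPartition-isPartition ps)) (∈-deduplicate⁻ _≟_ qs q∈)
  ; unique      = deduplicate-! _≟_ qs
  ; coefficient = multiplicity _≟_ qs
  ; expands     = expands
  } , All.universal (multiplicity≥0 _≟_ qs) _
  where
  _≟_ = List.≡-dec ℕ._≟_
  qs = map toPartition ps
  open ≡.≡-Reasoning
  expands : ∀ α → F α ≡ sumˣ (map (λ p → multiplicity _≟_ qs p ·ˣ e[ p ]) (deduplicate _≟_ qs)) α
  expands α = begin
    F α
      ≡⟨ ≃⇒≡ F≃ α ⟩
    sumˣ (map e[_] ps) α
      ≡⟨ sumˣ-coefficient ps e[_] α ⟩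
    ℤ∑.∑ ps (λ p → e[ p ] α)
      ≡⟨ ℤ∑.∑-cong ps (λ p → ≡.sym (≃⇒≡ (e[toPartition] p) α)) ⟩
    ℤ∑.∑ ps (λ p → e[ toPartition p ] α)
      ≡⟨ ℤ∑.∑-map toPartition ps (λ q → e[ q ] α) ⟨
    ℤ∑.∑ qs (λ q → e[ q ] α)
      ≡⟨ ∑-multiplicity _≟_ (λ q → e[ q ] α) qs ⟨
    ℤ∑.∑ (deduplicate _≟_ qs) (λ q → multiplicity _≟_ qs q ℤ.* e[ q ] α)
      ≡⟨ sumˣ-coefficient (deduplicate _≟_ qs) (λ q → multiplicity _≟_ qs q ·ˣ e[ q ]) α ⟨
    sumˣ (map (λ p → multiplicity _≟_ qs p ·ˣ e[ p ]) (deduplicate _≟_ qs)) α ∎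

-- The series of the theorem and their e-positivity.

open import Defs

g h : ℕ → ℤ⟦x⟧
g i = (+ i ℤ.- + 1) ·ˣ e i
h i = (+ i ℤ.- + 2) ·ˣ e i

X-path≈P : ∀ m n → CommutativeRing._≈_ (truncatedRing m) (X (path n)) (PathSum.P (truncatedRing m) var n)
X-path≈P m n α = ≡.trans (X≈chromatic m (path n) α) (ChromaticSum.chromatic-path (truncatedRing m) var n α)

module _ (m : ℕ) where

  private
    R = truncatedRing m
    module S = CommutativeRing (PowerSeries.seriesRing R)
  open Truncated m using (θ; one)
  open Algebra.Properties.Semiring.Mult (CommutativeRing.semiring R) using () renaming (_×_ to _•_)

  •-coefficient : ∀ n F α → (n • F) α ≡ (+ n) ℤ.* F α
  •-coefficient zero    F α = ≡.sym (ℤ.*-zeroˡ (F α))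
  •-coefficient (suc n) F α = ≡.trans (≡.cong (λ i → F α ℤ.+ i) (•-coefficient n F α)) (≡.sym (ℤ.suc-* (+ n) (F α)))

  -- The coefficients of θ E - E are (i - 1) e_i. This is -1 in degree 0, which `one` cancels, and 0
  -- in degree 1.
  G≥2≋ : G≥ 2 S.≈ (θ E S.- E S.+ one)
  G≥2≋ zero          α = ≡.sym (≡.trans (≡.cong (λ i → 0ℤ ℤ.+ ℤ.- i ℤ.+ 1ˣ (toList α)) (e₀≡1 (toList α)))
    (≡.trans (≡.cong (ℤ._+ 1ˣ (toList α)) (ℤ.+-identityˡ (ℤ.- 1ˣ (toList α)))) (ℤ.+-inverseˡ (1ˣ (toList α)))))
  G≥2≋ (suc zero)    α = ≡.sym (≡.trans (ℤ.+-identityʳ _)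
    (≡.trans (≡.cong (λ i → i ℤ.- e 1 (toList α)) (ℤ.+-identityʳ (e 1 (toList α)))) (ℤ.+-inverseʳ (e 1 (toList α)))))
  G≥2≋ (suc (suc n)) α = ≡.sym (≡.trans (ℤ.+-identityʳ _)
    (≡.trans (≡.cong (λ i → i ℤ.- e (2 ℕ.+ n) (toList α)) (•-coefficient (2 ℕ.+ n) (e (2 ℕ.+ n)) (toList α)))
    (≡.trans (≡.cong (λ i → (+ (2 ℕ.+ n)) ℤ.* e (2 ℕ.+ n) (toList α) ℤ.+ i) (≡.sym (ℤ.-1*i≡-i (e (2 ℕ.+ n) (toList α)))))
    (≡.sym (ℤ.*-distribʳ-+ (e (2 ℕ.+ n) (toList α)) (+ (2 ℕ.+ n)) (ℤ.- (+ 1)))))))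

  𝒳ₚ-recursion : 𝒳ₚ S.≈ (E S.+ 𝒳ₚ S.* G≥ 2)
  𝒳ₚ-recursion = Carlitz.carlitz-recursion R var {𝒳ₚ} {E} {G≥ 2} (X-path≈P m) (e≈elementary m) G≥2≋

  2·1≈1+1 : (α : Vec ℕ m) → ((+ 2) ·ˣ 1ˣ) (toList α) ≡ (1ˣ +ˣ 1ˣ) (toList α)
  2·1≈1+1 α = ≡.trans (ℤ.suc-* (+ 1) (1ˣ (toList α))) (≡.cong (λ i → 1ˣ (toList α) ℤ.+ i) (ℤ.*-identityˡ (1ˣ (toList α))))

  1·≈ : ∀ F (α : Vec ℕ m) → ((+ 1) ·ˣ F) (toList α) ≡ F (toList α)
  1·≈ F α = ℤ.*-identityˡ (F (toList α))

  private module Xₚ = Expansion R 𝒳ₚ e g h ((+ 2) ·ˣ 1ˣ) ((+ 1) ·ˣ 1ˣ) 2·1≈1+1 (1·≈ 1ˣ)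

  h+e≈g : ∀ i (α : Vec ℕ m) → (h (3 ℕ.+ i) +ˣ e (3 ℕ.+ i)) (toList α) ≡ g (3 ℕ.+ i) (toList α)
  h+e≈g i α = ≡.trans (ℤ.+-comm _ (e (3 ℕ.+ i) (toList α))) (≡.sym (ℤ.suc-* (+ suc i) (e (3 ℕ.+ i) (toList α))))

  ⊛-f≋expansion : ∀ k → (𝒳ₚ S.* f (2 ℕ.+ k)) S.≈ Xₚ.expansion k
  ⊛-f≋expansion = Xₚ.identity 𝒳ₚ-recursion (X-path≈P m 0) (1·≈ (e 2)) h+e≈g

  X-twin≈ : ∀ k j → CommutativeRing._≈_ R (X (twin (path (suc k ℕ.+ suc j)) (suc k ↑ʳ zero)))
            ((𝒳ₚ S.* f (2 ℕ.+ k)) (3 ℕ.+ (k ℕ.+ j)) +ˣ (𝒳ₚ S.* f (2 ℕ.+ k)) (3 ℕ.+ (k ℕ.+ j)))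
  X-twin≈ k j = Xₚ.twin-coefficient 𝒳ₚ-recursion (X-path≈P m 0) (1·≈ (e 2)) h+e≈g
    {X (twin (path (suc k ℕ.+ suc j)) (suc k ↑ʳ zero))} k j
    (ChromaticSum.chromatic-twin-formula R var {𝒳ₚ} {X (twin (path (suc k ℕ.+ suc j)) (suc k ↑ʳ zero))} k j (X-path≈P m)
      (X≈chromatic m (twin (path (suc k ℕ.+ suc j)) (suc k ↑ʳ zero))))

Generated : ℤ⟦x⟧⟦z⟧ → Set
Generated F = ∀ n → EGenerated (F n)

Generated-+ : ∀ {F G} → Generated F → Generated G → Generated (F + G)
Generated-+ F∈ G∈ n = generated-+ (F∈ n) (G∈ n)

Generated-* : ∀ {F G} → Generated F → Generated G → Generated (F * G)
Generated-* F∈ G∈ n = generated-sum (All.universal (λ i → generated-* (F∈ i) (G∈ (n ∸ i))) (upTo (suc n)))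

Generated-z^ : ∀ {F} k → EGenerated F → Generated (F z^ k)
Generated-z^ k F∈ n with does (n ℕ.≟ k)
... | true  = F∈
... | false = generated-0

Generated-sum : ∀ {a} {A : Set a} {F : A → ℤ⟦x⟧⟦z⟧} {as} → All (Generated ∘ F) as → Generated (foldr _+_ 0ᶻ (map F as))
Generated-sum []         n = generated-0
Generated-sum (F∈ ∷ Fs∈) n = generated-+ (F∈ n) (Generated-sum Fs∈ n)

-- At k = 0 the constant term would be -1.
Generated-G≥ : ∀ {k} → 1 ≤ k → Generated (G≥ k)
Generated-G≥ {suc k} _ zero    = generated-0
Generated-G≥ {suc k} _ (suc n) with does (suc k ℕ.≤? suc n)
... | true  = generated-· n (generated-e (suc n))
... | false = generated-0

Generated-𝒳ₚ : Generated 𝒳ₚ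
Generated-𝒳ₚ = <-rec (λ n → EGenerated (𝒳ₚ n)) λ n below →
  generated-resp (λ m → 𝒳ₚ-recursion m n)
    (generated-+ (generated-e n) (generated-sum (All.applyUpTo⁺₁ id (suc n) λ {i} i≤n → term n below i (ℕ.s≤s⁻¹ i≤n))))
  where
  term : ∀ n → (∀ {i} → i < n → EGenerated (𝒳ₚ i)) → ∀ i → i ≤ n → EGenerated (𝒳ₚ i *ˣ G≥ 2 (n ∸ i))
  term n below i i≤n with ℕ.m≤n⇒m<n∨m≡n i≤n
  ... | inj₁ i<n    = generated-* (below i<n) (Generated-G≥ (s≤s z≤n) (n ∸ i))
  -- The recursion mentions `𝒳ₚ n` itself, but only with the factor `G≥ 2 0`, which is zero.
  ... | inj₂ ≡.refl rewrite ℕ.n∸n≡0 n =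
    generated-resp (λ m → CommutativeRing.zeroʳ (truncatedRing m) (𝒳ₚ n)) generated-0

-- The expansion for ℓ = 2 + k; the theorem has a = k + 1 and b = k + 2.
expansionAt : ℕ → ℕ → ℕ → ℤ⟦x⟧⟦z⟧
expansionAt k a b =
    𝒳ₚ * foldr _+_ 0ᶻ (map (λ i → h (3 ℕ.+ i) z^ (3 ℕ.+ i)) (upTo a))
  + const (+ 2) * (E + 𝒳ₚ * G≥ (2 ℕ.+ b))
  + foldr _+_ 0ᶻ (map (λ i → (E + 𝒳ₚ * G≥ (suc b ∸ i)) * X (path (suc i)) z^ suc i) (upTo k))

Generated-expansionAt : ∀ k → Generated (expansionAt k (suc k) (2 ℕ.+ k))
Generated-expansionAt k = Generated-+ (Generated-+
  (Generated-* Generated-𝒳ₚ (Generated-sum (All.universal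
    (λ i → Generated-z^ (3 ℕ.+ i) (generated-· (suc i) (generated-e (3 ℕ.+ i)))) (upTo (suc k)))))
  (Generated-* (Generated-z^ 0 (generated-· 2 generated-1)) (Generated-B (s≤s z≤n))))
  (Generated-sum (All.applyUpTo⁺₁ id k λ {i} i<k →
    Generated-* (Generated-B (ℕ.m<n⇒0<n∸m (ℕ.m<n⇒m<1+n (ℕ.m<n⇒m<1+n (ℕ.m<n⇒m<1+n i<k)))))
      (Generated-z^ (suc i) (Generated-𝒳ₚ (suc i)))))
  where
  Generated-B : ∀ {l} → 1 ≤ l → Generated (E + 𝒳ₚ * G≥ l)
  Generated-B 1≤l = Generated-+ generated-e (Generated-* Generated-𝒳ₚ (Generated-G≥ 1≤l))

𝒳ₚ*f≃expansionAt : ∀ k n → (𝒳ₚ * f (2 ℕ.+ k)) n ≃ expansionAt k (suc k) (2 ℕ.+ k) n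
𝒳ₚ*f≃expansionAt k n m = ⊛-f≋expansion m k n

-- The statement places the twinned vertex by `fromℕ<`, the twin formula by `↑ʳ`; with n and v
-- abstract, the two are compared through `toℕ`.
generated-twin : ∀ k j n (v : Fin n) → suc k ℕ.+ suc j ≡ n → toℕ v ≡ suc k → EGenerated (X (twin (path n) v))
generated-twin k j n v ≡.refl toℕ-v = ≡.subst (λ w → EGenerated (X (twin (path n) w)))
  (Fin.toℕ-injective (≡.trans (Fin.toℕ-↑ʳ (suc k) zero) (≡.trans (ℕ.+-identityʳ (suc k)) (≡.sym toℕ-v))))
  (generated-resp {X (twin (path (suc k ℕ.+ suc j)) (suc k ↑ʳ zero))} {C +ˣ C} (λ m → X-twin≈ m k j) (generated-+ C∈ C∈))
  where
  C = (𝒳ₚ * f (2 ℕ.+ k)) (3 ℕ.+ (k ℕ.+ j))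
  C∈ : EGenerated C
  C∈ = generated-resp (𝒳ₚ*f≃expansionAt k (3 ℕ.+ (k ℕ.+ j))) (Generated-expansionAt k (3 ℕ.+ (k ℕ.+ j)))

Generated-𝒳-twinned : ∀ k (1≤ℓ : 1 ≤ 2 ℕ.+ k) → Generated (𝒳-twinned (2 ℕ.+ k) 1≤ℓ)
Generated-𝒳-twinned k 1≤ℓ zero    = generated-0
Generated-𝒳-twinned k 1≤ℓ (suc n) with 3 ℕ.+ k ℕ.≤? n
... | no  _   = generated-0
... | yes ℓ<n = generated-twin k (n ∸ (2 ℕ.+ k)) n _
  (≡.trans (ℕ.+-suc (suc k) (n ∸ (2 ℕ.+ k))) (ℕ.m+[n∸m]≡n (<⇒≤ ℓ<n))) (Fin.toℕ-fromℕ< (<⇒≤ ℓ<n))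

theorem3p24 : (ℓ : ℕ) (2≤ℓ : 2 ≤ ℓ) →
    let expansion =
            𝒳ₚ * (Σ[ i from 3 to ℓ ℕ.+ 1 ] ((+ i ℤ.- + 2) ·ˣ e i) z^ i)
          + const (+ 2) * (E + 𝒳ₚ * G≥ (ℓ ℕ.+ 2))
          + (Σ[ i from 1 to ℓ ℕ.∸ 2 ] (E + 𝒳ₚ * G≥ (ℓ ℕ.+ 2 ℕ.∸ i)) * X (path i) z^ i)
    in (𝒳ₚ * f ℓ ≋ expansion) × EPositive expansion × EPositive (𝒳-twinned ℓ (<⇒≤ 2≤ℓ))
theorem3p24 zero          ()
theorem3p24 (suc zero)    (s≤s ())
theorem3p24 (suc (suc k)) 2≤ℓ =
  -- The sums ℓ + 1 and ℓ + 2 of the statement unfold to k + 1 and k + 2 under constructors, so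
  -- commutativity is applied to just these two indices.
  ≡.subst₂ (λ a b → (𝒳ₚ * f (2 ℕ.+ k) ≋ expansionAt k a b) × EPositive (expansionAt k a b)
                     × EPositive (𝒳-twinned (2 ℕ.+ k) (<⇒≤ 2≤ℓ)))
    (ℕ.+-comm 1 k) (ℕ.+-comm 2 k)
    ( (λ n → ≃⇒≡ (𝒳ₚ*f≃expansionAt k n))
    , (λ n → generated⇒EPositive (Generated-expansionAt k n))
    , (λ n → generated⇒EPositive (Generated-𝒳-twinned k (<⇒≤ 2≤ℓ) n)))
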